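{- Let $q$ be a prime power and $m,n$ positive integers with $\max\{m,n\}>1$. If $T\in\mathrm{TSRI}(m,n;q)$, then the number of matrices $S\in\mathrm{TSR}(m,n;q)$ with $\det(XI_{mn}-S)=\det(XI_{mn}-T)$ is $$\frac{|\operatorname{GL}_m(\mathbb{F}_q)|}{q^m-1}.$$
   Context: An $(m,n)$-TSR matrix over $\mathbb{F}_q$ is a matrix $T\in \operatorname{M}_{mn}(\mathbb{F}_q)$ which, viewed as an $n\times n$ array of $m\times m$ blocks, has $I_m$ in block positions $(i+1,i)$ for $1\le i\le n-1$, has last block column $(c_0B,\dots,c_{n-1}B)^{T}$ (top to bottom) for some $c_i\in\mathbb{F}_q$ and $B\in \operatorname{M}_m(\mathbb{F}_q)$, and all other blocks zero. $\mathrm{TSR}(m,n;q)$ is the set of these and $\mathrm{TSRI}(m,n;q)$ the subset of those with characteristic polynomial irreducible in $\mathbb{F}_q[X]$. -}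

module Defs where

open import Level using (0ℓ)
open import Data.Nat as ℕ using (ℕ; zero; suc; _∸_; _^_; _≤_)
open import Data.Nat.Primality using (Prime)
open import Data.Fin as Fin using (Fin; toℕ; combine)
open import Data.Vec as Vec using (Vec; []; _∷_; lookup; tabulate; removeAt)
open import Data.List as List using (List; []; _∷_; length)
open import Data.List.Membership.Propositional using (_∈_)
open import Data.List.Relation.Unary.Unique.Propositional using (Unique)
open import Data.Product using (Σ; ∃; _×_; _,_)
open import Data.Sum using (_⊎_)
open import Data.Bool using (if_then_else_)
open import Relation.Nullary using (¬_; yes; no)
open import Relation.Nullary.Decidable using (⌊_⌋)
open import Relation.Binary.PropositionalEquality using (_≡_; _≢_)
open import Relation.Binary.Definitions using (DecidableEquality)
open import Algebra.Structures using (IsCommutativeRing)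
open import Function.Bundles using (_⇔_)

IsPrimePower : ℕ → Set
IsPrimePower q = Σ ℕ λ p → Σ ℕ λ k → Prime p × 1 ≤ k × q ≡ p ^ k

record FiniteField : Set₁ where
  field
    Carrier : Set
    _+_ _*_ : Carrier → Carrier → Carrier
    -_      : Carrier → Carrier
    0# 1#   : Carrier
    isCommutativeRing : IsCommutativeRing _≡_ _+_ _*_ -_ 0# 1#
    _≟_     : DecidableEquality Carrier
    0≢1     : 0# ≢ 1#
    inverse : ∀ x → x ≢ 0# → Σ Carrier λ y → x * y ≡ 1#
    elements : List Carrier
    elements-complete : ∀ x → x ∈ elements
    elements-unique   : Unique elements

  size : ℕ
  size = length elements

HasCard : {A : Set} → (A → Set) → ℕ → Set
HasCard {A} P k =
  Σ (List A) λ xs → Unique xs × (∀ x → (x ∈ xs) ⇔ P x) × length xs ≡ k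

Matrix : Set → ℕ → Set
Matrix A k = Vec (Vec A k) k

entry : {A : Set} {k : ℕ} → Matrix A k → Fin k → Fin k → A
entry M i j = lookup (lookup M i) j

module Det {R : Set} (_+_ _*_ : R → R → R) (-_ : R → R) (0r 1r : R) where

  altSum : {k : ℕ} → Vec R k → R
  altSum []       = 0r
  altSum (x ∷ xs) = x + (- altSum xs)

  det : {k : ℕ} → Matrix R k → R
  det {zero}  []       = 1r
  det {suc k} (r ∷ rs) =
    altSum (tabulate λ j →
      lookup r j * det (Vec.map (λ row → removeAt row j) rs))

module FF (𝔽 : FiniteField) where
  open FiniteField 𝔽

  F : Set
  F = Carrier

  -- Polynomials in F[X]: coefficient lists, constant term first.
  -- Two lists denote the same polynomial iff all coefficients agree
  -- (trailing zeros are irrelevant).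

  Poly : Set
  Poly = List F

  coeff : Poly → ℕ → F
  coeff []       _       = 0#
  coeff (a ∷ p)  zero    = a
  coeff (a ∷ p)  (suc i) = coeff p i

  _≈ₚ_ : Poly → Poly → Set
  p ≈ₚ p′ = ∀ i → coeff p i ≡ coeff p′ i

  _+ₚ_ : Poly → Poly → Poly
  []      +ₚ p′       = p′
  (a ∷ p) +ₚ []       = a ∷ p
  (a ∷ p) +ₚ (b ∷ p′) = (a + b) ∷ (p +ₚ p′)

  -ₚ_ : Poly → Poly
  -ₚ p = List.map -_ p

  _*ₚ_ : Poly → Poly → Poly
  []      *ₚ p′ = []
  (a ∷ p) *ₚ p′ = List.map (a *_) p′ +ₚ (0# ∷ (p *ₚ p′))

  0ₚ 1ₚ Xₚ : Poly
  0ₚ = []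
  1ₚ = 1# ∷ []
  Xₚ = 0# ∷ 1# ∷ []

  const : F → Poly
  const a = a ∷ []

  IsUnitₚ : Poly → Set
  IsUnitₚ f = Σ Poly λ h → (f *ₚ h) ≈ₚ 1ₚ

  Irreducible : Poly → Set
  Irreducible p =
    ¬ (p ≈ₚ 0ₚ) × ¬ IsUnitₚ p ×
    (∀ f g → p ≈ₚ (f *ₚ g) → IsUnitₚ f ⊎ IsUnitₚ g)

  detF : {k : ℕ} → Matrix F k → F
  detF = Det.det _+_ _*_ -_ 0# 1#

  detₚ : {k : ℕ} → Matrix Poly k → Poly
  detₚ = Det.det _+ₚ_ _*ₚ_ -ₚ_ 0ₚ 1ₚ

  δ : {k : ℕ} → Fin k → Fin k → F
  δ i j = if ⌊ i Fin.≟ j ⌋ then 1# else 0#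

  charPoly : {k : ℕ} → Matrix F k → Poly
  charPoly S = detₚ (tabulate λ i → tabulate λ j →
    (Xₚ *ₚ const (δ i j)) +ₚ (-ₚ const (entry S i j)))

  sumF : {k : ℕ} → (Fin k → F) → F
  sumF {zero}  f = 0#
  sumF {suc k} f = f Fin.zero + sumF (λ i → f (Fin.suc i))

  idMat : {k : ℕ} → Matrix F k
  idMat = tabulate λ i → tabulate λ j → δ i j

  _·_ : {k : ℕ} → Matrix F k → Matrix F k → Matrix F k
  M · N = tabulate λ i → tabulate λ j → sumF λ l → entry M i l * entry N l j

  IsGL : {k : ℕ} → Matrix F k → Set
  IsGL {k} M = Σ (Matrix F k) λ N → (M · N) ≡ idMat × (N · M) ≡ idMat

  -- (m,n)-TSR matrices.  An mn×mn matrix is indexed by Fin (n * m);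
  -- block row i : Fin n, inner row a : Fin m  ↦  combine i a = i·m + a.
  -- Block (i,j) is: c_i B if j is the last block column (j = n-1);
  -- I_m if i = j+1; 0 otherwise.

  tsrBlock : {m n : ℕ} → (Fin n → F) → Matrix F m →
             Fin n → Fin n → Fin m → Fin m → F
  tsrBlock {m} {n} c B i j a b with toℕ j ℕ.≟ (n ∸ 1)
  ... | yes _ = c i * entry B a b
  ... | no  _ with toℕ i ℕ.≟ suc (toℕ j)
  ...   | yes _ = δ a b
  ...   | no  _ = 0#

  IsTSR : (m n : ℕ) → Matrix F (n ℕ.* m) → Set
  IsTSR m n T =
    Σ (Fin n → F) λ c → Σ (Matrix F m) λ B →
      ∀ (i j : Fin n) (a b : Fin m) →
        entry T (combine i a) (combine j b) ≡ tsrBlock c B i j a b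

  IsTSRI : (m n : ℕ) → Matrix F (n ℕ.* m) → Set
  IsTSRI m n T = IsTSR m n T × Irreducible (charPoly T)

module Submission where

-- Write V = F^{nm}, let W ≅ F^m be its first block, and let f be the characteristic
-- polynomial of T. By Cayley–Hamilton, V is a one-dimensional vector space over the field
-- K = F[X]/(f). For w ≠ 0 in W one has W = F[B]w, since the vectors all of whose blocks lie
-- in F[B]w form a T-stable subspace; as I ⊗ B commutes with T, the elements of K that send w
-- into W form a multiplicatively closed set of size q^m, so its nonzero elements are exactly the
-- roots of Y^(q^m - 1) = 1, a condition that depends on f alone. Hence, if S is a TSR matrix
-- with the same characteristic polynomial and u ≠ 0 in W, the unique F[X]-isomorphism from
-- (V, T) to (V, S) with w ↦ u maps W to W and is I ⊗ P for some P in GL_m. So P ↦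
-- ((I ⊗ P) T (I ⊗ P)⁻¹, P w) is a bijection from GL_m onto the pairs (S, u).

-- In general S does not determine c and B, since scaling c by a nonzero constant and B by its
-- inverse gives the same matrix. An arbitrary S is therefore compared with T through F[X]-linear
-- maps, and P is read off from such a map. The size q^m comes from the bijection K → V, evaluation
-- at w: the set in question is the preimage of W. The equation Y^(q^m - 1) = 1 is what carries this
-- set over to S: a field has at most one multiplicative subgroup of a given finite order, so the
-- subgroups cut out by w in (V, T) and by u in (V, S) coincide. The shape I ⊗ P comes from the
-- identity blocks: T moves each block except the last unchanged onto the next one, so a map that
-- commutes with the two operators and preserves W repeats on every block what it does on W. A
-- conjugate of T by I ⊗ P keeps the characteristic polynomial f because f is the only monic
-- polynomial of degree mn that annihilates a given nonzero vector.

open import Defs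
open import Level using (0ℓ)
open import Data.Nat as ℕ using (ℕ; zero; suc; z≤n; s≤s; _≤_; _<_; _∸_; _⊔_)
import Data.Nat.Properties as ℕₚ
open import Data.Integer as ℤ using (ℤ; 0ℤ; 1ℤ)
import Data.Integer.Properties as ℤₚ
import Data.Sign as Sign
open import Data.Maybe as Maybe using (Maybe)
open import Data.Empty using (⊥; ⊥-elim)
open import Data.Product using (Σ; ∃; ∃₂; _×_; _,_; proj₁; proj₂)
open import Data.Sum using (_⊎_; inj₁; inj₂; [_,_])
open import Data.Fin as Fin using (Fin; zero; suc; toℕ; fromℕ; inject₁; combine; remQuot; _↑ˡ_; _↑ʳ_)
import Data.Fin.Properties as Finₚ
open import Data.Fin.Induction using (<-weakInduction)
open import Data.List as List using (List; []; _∷_; _++_; length)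
import Data.List.Properties as Listₚ
open import Data.List.Membership.Propositional using (_∈_; find)
open import Data.List.Membership.Propositional.Properties
  using (∈-∃++; ∈-++⁻; ∈-++⁺ˡ; ∈-++⁺ʳ; ∈-map⁺; ∈-allFin; ∈-filter⁺; ∈-filter⁻;
         ∈-cartesianProductWith⁺; ∈-cartesianProduct⁺; ∈-cartesianProduct⁻)
open import Data.List.Relation.Unary.Any as Any using (Any; here; there)
import Data.List.Relation.Unary.Any.Properties as Anyₚ
open import Data.List.Relation.Unary.All as All using (All; []; _∷_)
import Data.List.Relation.Unary.All.Properties as Allₚ
open import Data.List.Relation.Unary.AllPairs as AllPairs using (AllPairs; []; _∷_)
import Data.List.Relation.Unary.AllPairs.Properties as AllPairsₚ
open import Data.List.Relation.Unary.Unique.Propositional using (Unique)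
import Data.List.Relation.Unary.Unique.Propositional.Properties as Uniqueₚ
open import Data.Vec as Vec
  using (Vec; []; _∷_; lookup; tabulate; removeAt; toList; replicate; zipWith)
import Data.Vec.Properties as Vecₚ
open import Function using (_∘_; id)
open import Function.Bundles using (Equivalence)
open import Relation.Nullary using (¬_; Dec; yes; no; contradiction)
open import Relation.Nullary.Decidable using (¬?; dec⇒maybe)
open import Relation.Binary.Definitions using (Decidable; DecidableEquality)
open import Relation.Binary.PropositionalEquality
  using (_≡_; _≢_; refl; sym; trans; cong; cong₂; subst; module ≡-Reasoning)
open import Algebra.Bundles using (CommutativeRing)
import Algebra.Properties.AbelianGroup as AbelianGroupProperties
import Algebra.Properties.Ring as RingProperties
import Algebra.Properties.Semiring.Mult.TCOptimised as Multiples
import Algebra.Solver.Ring as RingSolver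
import Algebra.Solver.Ring.AlmostCommutativeRing as ACR

-- Ring identities with integer coefficients.

-- The library's solvers need decidable equality of coefficients, which an abstract
-- ring lacks, so coefficients are integers.
module IntegerSolver (R : CommutativeRing 0ℓ 0ℓ) where
  open CommutativeRing R hiding (refl; sym; trans; setoid)
  open CommutativeRing R using () renaming
    (refl to ≈refl; sym to ≈sym; trans to ≈trans; setoid to ≈setoid)
  open import Data.Integer using (+_; -[1+_])
  open RingProperties ring
  open AbelianGroupProperties +-abelianGroup
    using () renaming (⁻¹-∙-comm to neg-+; ⁻¹-involutive to neg-neg; ε⁻¹≈ε to neg-0)
  open Multiples semiring using (×-homo-+; ×1-homo-*; 1+×) renaming (_×_ to _·ⁿ_)
  open import Relation.Binary.Reasoning.Setoid ≈setoid

  ⟦_⟧ᶻ : ℤ → Carrier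
  ⟦ + n ⟧ᶻ      = n ·ⁿ 1#
  ⟦ -[1+ n ] ⟧ᶻ = - (suc n ·ⁿ 1#)

  ⊖-homo : ∀ m n → ⟦ m ℤ.⊖ n ⟧ᶻ ≈ m ·ⁿ 1# - n ·ⁿ 1#
  ⊖-homo m zero = ≈sym (≈trans (+-congˡ neg-0) (+-identityʳ _))
  ⊖-homo zero (suc n) = ≈sym (+-identityˡ _)
  ⊖-homo (suc m) (suc n) = begin
    ⟦ suc m ℤ.⊖ suc n ⟧ᶻ               ≡⟨ cong ⟦_⟧ᶻ (ℤₚ.[1+m]⊖[1+n]≡m⊖n m n) ⟩
    ⟦ m ℤ.⊖ n ⟧ᶻ                       ≈⟨ ⊖-homo m n ⟩
    m ·ⁿ 1# - n ·ⁿ 1#                    ≈⟨ +-congʳ (+-identityʳ _) ⟨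
    (m ·ⁿ 1# + 0#) - n ·ⁿ 1#             ≈⟨ +-congʳ (+-congˡ (-‿inverseʳ 1#)) ⟨
    (m ·ⁿ 1# + (1# - 1#)) - n ·ⁿ 1#      ≈⟨ +-congʳ (+-assoc _ _ _) ⟨
    ((m ·ⁿ 1# + 1#) - 1#) - n ·ⁿ 1#      ≈⟨ +-assoc _ _ _ ⟩
    (m ·ⁿ 1# + 1#) + (- 1# - n ·ⁿ 1#)    ≈⟨ +-cong (+-comm _ _) (neg-+ 1# (n ·ⁿ 1#)) ⟩
    (1# + m ·ⁿ 1#) - (1# + n ·ⁿ 1#)      ≈⟨ +-cong (1+× m 1#) (-‿cong (1+× n 1#)) ⟨
    suc m ·ⁿ 1# - suc n ·ⁿ 1#            ∎

  neg-homo : ∀ i → ⟦ ℤ.- i ⟧ᶻ ≈ - ⟦ i ⟧ᶻ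
  neg-homo (+ zero)   = ≈sym neg-0
  neg-homo (+ suc n)  = ≈refl
  neg-homo -[1+ n ]   = ≈sym (neg-neg _)

  +-homo : ∀ i j → ⟦ i ℤ.+ j ⟧ᶻ ≈ ⟦ i ⟧ᶻ + ⟦ j ⟧ᶻ
  +-homo (+ m) (+ n)           = ×-homo-+ 1# m n
  +-homo (+ m) -[1+ n ]        = ⊖-homo m (suc n)
  +-homo -[1+ m ] (+ n)        = ≈trans (⊖-homo n (suc m)) (+-comm _ _)
  +-homo -[1+ m ] -[1+ n ]     = begin
    - (suc (suc (m ℕ.+ n)) ·ⁿ 1#)        ≡⟨ cong (λ k → - (suc k ·ⁿ 1#)) (sym (ℕₚ.+-suc m n)) ⟩
    - ((suc m ℕ.+ suc n) ·ⁿ 1#)          ≈⟨ -‿cong (×-homo-+ 1# (suc m) (suc n)) ⟩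
    - (suc m ·ⁿ 1# + suc n ·ⁿ 1#)         ≈⟨ neg-+ _ _ ⟨
    - (suc m ·ⁿ 1#) - (suc n ·ⁿ 1#)       ∎

  *-homo : ∀ i j → ⟦ i ℤ.* j ⟧ᶻ ≈ ⟦ i ⟧ᶻ * ⟦ j ⟧ᶻ
  *-homo (+ m) (+ n) = ≈trans (reflexive (cong ⟦_⟧ᶻ (ℤₚ.+◃n≡+n (m ℕ.* n)))) (×1-homo-* m n)
  *-homo (+ m) -[1+ n ] = begin
    ⟦ Sign.- ℤ.◃ (m ℕ.* suc n) ⟧ᶻ  ≡⟨ cong ⟦_⟧ᶻ (ℤₚ.-◃n≡-n (m ℕ.* suc n)) ⟩
    ⟦ ℤ.- (+ (m ℕ.* suc n)) ⟧ᶻ      ≈⟨ neg-homo (+ (m ℕ.* suc n)) ⟩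
    - ((m ℕ.* suc n) ·ⁿ 1#)         ≈⟨ -‿cong (×1-homo-* m (suc n)) ⟩
    - (m ·ⁿ 1# * suc n ·ⁿ 1#)        ≈⟨ -‿distribʳ-* _ _ ⟩
    m ·ⁿ 1# * - (suc n ·ⁿ 1#)        ∎
  *-homo -[1+ m ] (+ n) = begin
    ⟦ Sign.- ℤ.◃ (suc m ℕ.* n) ⟧ᶻ  ≡⟨ cong ⟦_⟧ᶻ (ℤₚ.-◃n≡-n (suc m ℕ.* n)) ⟩
    ⟦ ℤ.- (+ (suc m ℕ.* n)) ⟧ᶻ      ≈⟨ neg-homo (+ (suc m ℕ.* n)) ⟩
    - ((suc m ℕ.* n) ·ⁿ 1#)         ≈⟨ -‿cong (×1-homo-* (suc m) n) ⟩
    - (suc m ·ⁿ 1# * n ·ⁿ 1#)        ≈⟨ -‿distribˡ-* _ _ ⟩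
    - (suc m ·ⁿ 1#) * n ·ⁿ 1#        ∎
  *-homo -[1+ m ] -[1+ n ] = begin
    (suc m ℕ.* suc n) ·ⁿ 1#         ≈⟨ ×1-homo-* (suc m) (suc n) ⟩
    suc m ·ⁿ 1# * suc n ·ⁿ 1#        ≈⟨ neg-neg _ ⟨
    - - (suc m ·ⁿ 1# * suc n ·ⁿ 1#)  ≈⟨ -‿cong (-‿distribˡ-* _ _) ⟩
    - (- (suc m ·ⁿ 1#) * suc n ·ⁿ 1#) ≈⟨ -‿distribʳ-* _ _ ⟩
    - (suc m ·ⁿ 1#) * - (suc n ·ⁿ 1#) ∎

  almostCommutativeRing : ACR.AlmostCommutativeRing 0ℓ 0ℓ
  almostCommutativeRing = ACR.fromCommutativeRing R

  morphism : ℤ.+-*-rawRing ACR.-Raw-AlmostCommutative⟶ almostCommutativeRing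
  morphism = record
    { ⟦_⟧ = ⟦_⟧ᶻ ; +-homo = +-homo ; *-homo = *-homo ; -‿homo = neg-homo
    ; 0-homo = ≈refl ; 1-homo = ≈refl }

  ⟦⟧ᶻ-≟ : ∀ i j → Maybe (⟦ i ⟧ᶻ ≈ ⟦ j ⟧ᶻ)
  ⟦⟧ᶻ-≟ i j = Maybe.map (λ e → reflexive (cong ⟦_⟧ᶻ e)) (dec⇒maybe (i ℤ.≟ j))

  open RingSolver ℤ.+-*-rawRing almostCommutativeRing morphism ⟦⟧ᶻ-≟ public

-- Comparing the sizes of finite lists.

length-≤-by-relation :
  {A B : Set} (R : A → B → Set) {xs : List A} {ys : List B} → Unique xs →
  (∀ {x} → x ∈ xs → ∃ λ y → y ∈ ys × R x y) →
  (∀ {x x′ y} → R x y → R x′ y → x ≡ x′) →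
  length xs ≤ length ys
length-≤-by-relation R [] _ _ = z≤n
length-≤-by-relation R {x ∷ xs} {ys} (x∉xs ∷ u) image inj
  with image (here refl)
... | y , y∈ys , Rxy with ∈-∃++ y∈ys
-- The partner of the head is cut out of `ys`. Injectivity of `R` keeps the partners of the other
-- elements away from the removed place, so the induction continues with one element less on both
-- sides.
... | as , bs , refl = subst (suc (length xs) ≤_) (sym length-split)
        (s≤s (length-≤-by-relation R u image′ inj))
  where
  length-split : length (as ++ y ∷ bs) ≡ suc (length (as ++ bs))
  length-split = trans (Listₚ.length-++ as)
    (trans (ℕₚ.+-suc _ _) (cong suc (sym (Listₚ.length-++ as))))
  image′ : ∀ {x′} → x′ ∈ xs → ∃ λ z → z ∈ as ++ bs × R x′ z
  image′ x′∈xs with image (there x′∈xs)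
  ... | z , z∈ , Rx′z with ∈-++⁻ as z∈
  ... | inj₁ z∈as = z , ∈-++⁺ˡ z∈as , Rx′z
  ... | inj₂ (there z∈bs) = z , ∈-++⁺ʳ as z∈bs , Rx′z
  ... | inj₂ (here refl) = ⊥-elim (All.lookup x∉xs x′∈xs (inj Rxy Rx′z))

-- Were y missed, y in front of the images would be a list without repetitions that is longer than
-- `xs` and contained in it.
injective⇒surjective :
  {A : Set} → DecidableEquality A → (xs : List A) → Unique xs → (∀ x → x ∈ xs) →
  (f : A → A) → (∀ {x y} → f x ≡ f y → x ≡ y) → ∀ y → ∃ λ x → f x ≡ y
injective⇒surjective _≟_ xs u complete f inj y
  with Any.any? (λ x → f x ≟ y) xs
... | yes p = Any.lookup p , Anyₚ.lookup-result p
... | no ¬p = contradiction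
  (length-≤-by-relation _≡_ {y ∷ List.map f xs} {xs}
    (Allₚ.¬Any⇒All¬ _ (¬p ∘ Any.map sym ∘ Anyₚ.map⁻) ∷ Uniqueₚ.map⁺ inj u)
    (λ {z} _ → z , complete z , refl)
    (λ p q → trans p (sym q)))
  (subst (λ k → ¬ suc k ≤ length xs) (sym (Listₚ.length-map f xs)) (ℕₚ.<-irrefl refl))

length-cartesianProductWith : {A B C : Set} (f : A → B → C) (xs : List A) (ys : List B) →
  length (List.cartesianProductWith f xs ys) ≡ length xs ℕ.* length ys
length-cartesianProductWith f []       ys = refl
length-cartesianProductWith f (x ∷ xs) ys = trans (Listₚ.length-++ (List.map (f x) ys))
  (cong₂ ℕ._+_ (Listₚ.length-map (f x) ys) (length-cartesianProductWith f xs ys))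

-- Finite multiplicative subsets of an integral domain.

power : {A : Set} → (A → A → A) → A → A → ℕ → A
power _*_ 1# x zero    = 1#
power _*_ 1# x (suc n) = x * power _*_ 1# x n

Nontrivial : CommutativeRing 0ℓ 0ℓ → Set
Nontrivial R = ¬ 1# ≈ 0#
  where open CommutativeRing R

NoZeroDivisors : CommutativeRing 0ℓ 0ℓ → Set
NoZeroDivisors R = ∀ x y → x * y ≈ 0# → ¬ x ≈ 0# → y ≈ 0#
  where open CommutativeRing R

-- Equality is an arbitrary equivalence because the intended instance is F[X] with congruence modulo
-- f as its equality; the field K is never formed as a quotient type.
module FiniteSubgroup (R : CommutativeRing 0ℓ 0ℓ) (_≟_ : Decidable (CommutativeRing._≈_ R))
  (1≉0 : Nontrivial R) (integral : NoZeroDivisors R) where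

  open CommutativeRing R hiding (refl; sym; trans; setoid) renaming (Carrier to A)
  open CommutativeRing R using () renaming
    (refl to ≈refl; sym to ≈sym; trans to ≈trans; setoid to ≈setoid)
  open import Relation.Binary.Reasoning.Setoid ≈setoid
  open IntegerSolver R using (solve; con; _:+_; _:*_; _:-_; _:=_)

  infixr 8 _^_
  _^_ : A → ℕ → A
  _^_ = power _*_ 1#

  -- evaluation of the monic polynomial with the given non-leading coefficients
  monic : List A → A → A
  monic []       x = 1#
  monic (c ∷ cs) x = c + x * monic cs x

  -- Synthetic division by X - a: the non-leading coefficients `ds` of the quotient are the partial
  -- Horner values at a.
  monic-factor : ∀ c cs a → Σ (List A) λ ds → length ds ≡ length cs ×
    (∀ x → monic (c ∷ cs) x ≈ monic (c ∷ cs) a + (x - a) * monic ds x)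
  monic-factor c [] a = [] , refl , λ x →
    solve 3 (λ c x a → (c :+ x :* con 1ℤ) := ((c :+ a :* con 1ℤ) :+ (x :- a) :* con 1ℤ)) ≈refl c x a
  monic-factor c (d ∷ cs) a with monic-factor d cs a
  ... | ds , len , eq = monic (d ∷ cs) a ∷ ds , cong suc len , λ x → begin
    c + x * monic (d ∷ cs) x
      ≈⟨ +-congˡ (*-congˡ (eq x)) ⟩
    c + x * (monic (d ∷ cs) a + (x - a) * monic ds x)
      ≈⟨ solve 5 (λ c x a m n → (c :+ x :* (m :+ (x :- a) :* n))
             := ((c :+ a :* m) :+ (x :- a) :* (m :+ x :* n)))
           ≈refl c x a (monic (d ∷ cs) a) (monic ds x) ⟩
    (c + a * monic (d ∷ cs) a) + (x - a) * (monic (d ∷ cs) a + x * monic ds x) ∎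

  x-y≈0⇒x≈y : ∀ {x y} → x - y ≈ 0# → x ≈ y
  x-y≈0⇒x≈y {x} {y} eq = begin
    x            ≈⟨ solve 2 (λ x y → x := ((x :- y) :+ y)) ≈refl x y ⟩
    (x - y) + y  ≈⟨ +-congʳ eq ⟩
    0# + y       ≈⟨ +-identityˡ y ⟩
    y            ∎

  -- A root y splits off the factor X - y. Every other root makes this factor nonzero, hence is a
  -- root of the quotient, whose degree is one less.
  roots≤degree : ∀ cs ys → AllPairs (λ x y → ¬ x ≈ y) ys →
    All (λ y → monic cs y ≈ 0#) ys → length ys ≤ length cs
  roots≤degree cs [] _ _ = z≤n
  roots≤degree [] (y ∷ ys) _ (r ∷ _) = ⊥-elim (1≉0 r)
  roots≤degree (c ∷ cs) (y ∷ ys) (y∉ys ∷ u) (r ∷ rs) with monic-factor c cs y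
  ... | ds , len , eq = s≤s (subst (length ys ≤_) len
          (roots≤degree ds ys u (All.zipWith root (y∉ys , rs))))
    where
    root : ∀ {x} → (¬ y ≈ x) × monic (c ∷ cs) x ≈ 0# → monic ds x ≈ 0#
    root {x} (y≉x , rx) = integral _ _ (begin
      (x - y) * monic ds x
        ≈⟨ +-identityˡ _ ⟨
      0# + (x - y) * monic ds x
        ≈⟨ +-congʳ r ⟨
      monic (c ∷ cs) y + (x - y) * monic ds x
        ≈⟨ eq x ⟨
      monic (c ∷ cs) x
        ≈⟨ rx ⟩
      0# ∎) (λ e → y≉x (≈sym (x-y≈0⇒x≈y e)))

  product : List A → A
  product []       = 1#
  product (x ∷ xs) = x * product xs

  product-extract : ∀ {y xs} → Any (y ≈_) xs → Σ (List A) λ zs →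
    product xs ≈ y * product zs × suc (length zs) ≡ length xs ×
    (∀ {z} → ¬ y ≈ z → Any (z ≈_) xs → Any (z ≈_) zs)
  product-extract {y} {x ∷ xs} (here y≈x) =
    xs , *-congʳ (≈sym y≈x) , refl , λ where
      y≉z (here z≈x) → ⊥-elim (y≉z (≈trans y≈x (≈sym z≈x)))
      y≉z (there p)  → p
  product-extract {y} {x ∷ xs} (there p) with product-extract p
  ... | zs , eq , len , sub = x ∷ zs
    , ≈trans (*-congˡ eq)
        (solve 3 (λ x y z → (x :* (y :* z)) := (y :* (x :* z))) ≈refl x y (product zs))
    , cong suc len
    , λ where
      y≉z (here z≈x) → here z≈x
      y≉z (there q)  → there (sub y≉z q)

  -- Distinct elements that all lie in a list of the same length exhaust it. Each y is matched with
  -- an occurrence in `xs`, which is then removed; the remaining ys differ from y and survive the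
  -- removal.
  product-permuted : ∀ ys xs → length ys ≡ length xs → AllPairs (λ x y → ¬ x ≈ y) ys →
    All (λ y → Any (y ≈_) xs) ys → product ys ≈ product xs
  product-permuted [] [] _ _ _ = ≈refl
  product-permuted (y ∷ ys) xs len (y∉ys ∷ u) (p ∷ ps) with product-extract p
  ... | zs , eq , len′ , sub = ≈trans
    (*-congˡ (product-permuted ys zs (ℕₚ.suc-injective (trans len (sym len′))) u
      (All.zipWith (λ (y≉z , q) → sub y≉z q) (y∉ys , ps))))
    (≈sym eq)

  product-nonzero : ∀ {xs} → All (λ x → ¬ x ≈ 0#) xs → ¬ product xs ≈ 0#
  product-nonzero []       eq = 1≉0 eq
  product-nonzero (n ∷ ns) eq = product-nonzero ns (integral _ _ eq n)

  *-cancelˡ : ∀ {x y z} → ¬ x ≈ 0# → x * y ≈ x * z → y ≈ z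
  *-cancelˡ {x} {y} {z} x≉0 eq = x-y≈0⇒x≈y (integral _ _ (begin
    x * (y - z)   ≈⟨ solve 3 (λ x y z → (x :* (y :- z)) := (x :* y :- (x :* z))) ≈refl x y z ⟩
    x * y - x * z ≈⟨ +-congʳ eq ⟩
    x * z - x * z ≈⟨ -‿inverseʳ _ ⟩
    0#            ∎) x≉0)

  product-scale : ∀ x ys → product (List.map (x *_) ys) ≈ x ^ length ys * product ys
  product-scale x []       = ≈sym (*-identityˡ 1#)
  product-scale x (y ∷ ys) = ≈trans (*-congˡ (product-scale x ys))
    (solve 4 (λ x y p q → ((x :* y) :* (p :* q)) := ((x :* p) :* (y :* q)))
      ≈refl x y (x ^ length ys) (product ys))

  Any-nonempty : ∀ {P : A → Set} {xs} → Any P xs → 1 ≤ length xs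
  Any-nonempty (here  _) = s≤s z≤n
  Any-nonempty (there _) = s≤s z≤n

  module _ (xs : List A) (distinct : AllPairs (λ x y → ¬ x ≈ y) xs)
           (nonzero : All (λ x → ¬ x ≈ 0#) xs) where

    -- Multiplication by x permutes xs, so the product of xs is multiplied by
    -- x ^ length xs and unchanged.
    member⇒power≈1 : ∀ {x} → ¬ x ≈ 0# → All (λ y → Any (x * y ≈_) xs) xs →
      x ^ length xs ≈ 1#
    member⇒power≈1 {x} x≉0 closed = *-cancelˡ (product-nonzero nonzero) (begin
      product xs * x ^ length xs     ≈⟨ *-comm _ _ ⟩
      x ^ length xs * product xs     ≈⟨ product-scale x xs ⟨
      product (List.map (x *_) xs)   ≈⟨ product-permuted _ xs (Listₚ.length-map _ xs)
                                          (distinct-scaled distinct) (Allₚ.map⁺ closed) ⟩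
      product xs                     ≈⟨ *-identityʳ _ ⟨
      product xs * 1#                ∎)
      where
      distinct-scaled : ∀ {ys} → AllPairs (λ x y → ¬ x ≈ y) ys →
        AllPairs (λ x y → ¬ x ≈ y) (List.map (x *_) ys)
      distinct-scaled []        = []
      distinct-scaled (ns ∷ u) =
        Allₚ.map⁺ (All.map (λ n e → n (*-cancelˡ x≉0 e)) ns) ∷ distinct-scaled u

    -- Otherwise X ^ length xs - 1 would have 1 + length xs roots.
    power≈1⇒member : Any (1# ≈_) xs →
      All (λ x → All (λ y → Any (x * y ≈_) xs) xs) xs →
      ∀ {x} → x ^ length xs ≈ 1# → Any (x ≈_) xs
    power≈1⇒member one closed {x} eq with Any.any? (x ≟_) xs
    ... | yes p = p
    ... | no ¬p = contradiction (roots≤degree (coeffs (length xs)) (x ∷ xs)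
            (Allₚ.¬Any⇒All¬ xs ¬p ∷ distinct)
            (root x nonempty eq ∷ All.zipWith (λ {y} (n , c) → root y nonempty (member⇒power≈1 n c)) (nonzero , closed)))
            (subst (λ k → ¬ suc (length xs) ≤ k) (sym (length-coeffs nonempty)) (ℕₚ.<-irrefl refl))
      where
      -- Non-leading coefficients of X^n - 1, constant term first. The value at 0 is a filler: the
      -- list contains 1, so its length is positive.
      coeffs : ℕ → List A
      coeffs zero    = []
      coeffs (suc n) = - 1# ∷ List.replicate n 0#
      nonempty : 1 ≤ length xs
      nonempty = Any-nonempty one
      length-coeffs : ∀ {n} → 1 ≤ n → length (coeffs n) ≡ n
      length-coeffs {suc n} _ = cong suc (Listₚ.length-replicate n)
      monomial : ∀ n y → monic (List.replicate n 0#) y ≈ y ^ n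
      monomial zero    y = ≈refl
      monomial (suc n) y = ≈trans (+-identityˡ _) (*-congˡ (monomial n y))
      root : ∀ {n} y → 1 ≤ n → y ^ n ≈ 1# → monic (coeffs n) y ≈ 0#
      root {suc n} y _ e = begin
        - 1# + y * monic (List.replicate n 0#) y  ≈⟨ +-congˡ (*-congˡ (monomial n y)) ⟩
        - 1# + y ^ suc n                          ≈⟨ +-congˡ e ⟩
        - 1# + 1#                                 ≈⟨ -‿inverseˡ 1# ⟩
        0#                                        ∎

-- The polynomial ring F[X] on coefficient lists.

module Polynomials (𝔽 : FiniteField) where
  open FiniteField 𝔽 using (0#; 1#; _≟_; isCommutativeRing)
  open FF 𝔽

  fieldRing : CommutativeRing 0ℓ 0ℓ
  fieldRing = record { isCommutativeRing = isCommutativeRing }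

  module 𝔽ᵣ = CommutativeRing fieldRing
  open 𝔽ᵣ using (_+_; _*_; -_)
  module 𝔽ₛ = IntegerSolver fieldRing
  open 𝔽ₛ using (solve; con; _:+_; _:*_; _:-_; :-_; _:=_)
  open ≡-Reasoning

  0+0≡0 : 0# + 0# ≡ 0#
  0+0≡0 = 𝔽ᵣ.+-identityˡ 0#

  -0≡0 : - 0# ≡ 0#
  -0≡0 = solve 0 ((:- con 0ℤ) := con 0ℤ) refl

  -- A wrapper around `_≈ₚ_`: coefficientwise equations alone would not let the two polynomials be
  -- inferred from a proof.
  record _≋_ (p q : Poly) : Set where
    constructor ext
    field at : p ≈ₚ q
  open _≋_ public
  infix 4 _≋_

  scale : F → Poly → Poly
  scale a = List.map (a *_)

  coeff-+ : ∀ p q i → coeff (p +ₚ q) i ≡ coeff p i + coeff q i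
  coeff-+ []      q       i       = sym (𝔽ᵣ.+-identityˡ _)
  coeff-+ (a ∷ p) []      i       = sym (𝔽ᵣ.+-identityʳ _)
  coeff-+ (a ∷ p) (b ∷ q) zero    = refl
  coeff-+ (a ∷ p) (b ∷ q) (suc i) = coeff-+ p q i

  coeff-neg : ∀ p i → coeff (-ₚ p) i ≡ - coeff p i
  coeff-neg []      i       = sym -0≡0
  coeff-neg (a ∷ p) zero    = refl
  coeff-neg (a ∷ p) (suc i) = coeff-neg p i

  coeff-scale : ∀ a p i → coeff (scale a p) i ≡ a * coeff p i
  coeff-scale a []      i       = sym (𝔽ᵣ.zeroʳ a)
  coeff-scale a (b ∷ p) zero    = refl
  coeff-scale a (b ∷ p) (suc i) = coeff-scale a p i

  coeff-*-zero : ∀ a p q → coeff ((a ∷ p) *ₚ q) 0 ≡ a * coeff q 0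
  coeff-*-zero a p q = trans (coeff-+ (scale a q) _ 0)
    (trans (𝔽ᵣ.+-identityʳ _) (coeff-scale a q 0))

  coeff-*-suc : ∀ a p q i →
    coeff ((a ∷ p) *ₚ q) (suc i) ≡ a * coeff q (suc i) + coeff (p *ₚ q) i
  coeff-*-suc a p q i = trans (coeff-+ (scale a q) _ (suc i))
    (cong (_+ coeff (p *ₚ q) i) (coeff-scale a q (suc i)))

  ≋-refl : ∀ {p} → p ≋ p
  ≋-refl = ext λ _ → refl

  ≋-sym : ∀ {p q} → p ≋ q → q ≋ p
  ≋-sym e = ext λ i → sym (at e i)

  ≋-trans : ∀ {p q r} → p ≋ q → q ≋ r → p ≋ r
  ≋-trans e e′ = ext λ i → trans (at e i) (at e′ i)

  ∷-cong : ∀ {a p q} → p ≋ q → (a ∷ p) ≋ (a ∷ q)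
  ∷-cong e = ext λ { zero → refl ; (suc i) → at e i }

  +ₚ-cong : ∀ {p p′ q q′} → p ≋ p′ → q ≋ q′ → (p +ₚ q) ≋ (p′ +ₚ q′)
  +ₚ-cong {p} {p′} {q} {q′} e e′ = ext λ i → trans (coeff-+ p q i)
    (trans (cong₂ _+_ (at e i) (at e′ i)) (sym (coeff-+ p′ q′ i)))

  +ₚ-assoc : ∀ p q r → ((p +ₚ q) +ₚ r) ≋ (p +ₚ (q +ₚ r))
  +ₚ-assoc p q r = ext λ i → begin
    coeff ((p +ₚ q) +ₚ r) i              ≡⟨ trans (coeff-+ (p +ₚ q) r i) (cong (_+ coeff r i) (coeff-+ p q i)) ⟩
    (coeff p i + coeff q i) + coeff r i  ≡⟨ 𝔽ᵣ.+-assoc _ _ _ ⟩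
    coeff p i + (coeff q i + coeff r i)  ≡⟨ trans (coeff-+ p (q +ₚ r) i) (cong (coeff p i +_) (coeff-+ q r i)) ⟨
    coeff (p +ₚ (q +ₚ r)) i              ∎

  +ₚ-comm : ∀ p q → (p +ₚ q) ≋ (q +ₚ p)
  +ₚ-comm p q = ext λ i →
    trans (coeff-+ p q i) (trans (𝔽ᵣ.+-comm _ _) (sym (coeff-+ q p i)))

  +ₚ-identityʳ : ∀ p → (p +ₚ []) ≋ p
  +ₚ-identityʳ p = ext λ i → trans (coeff-+ p [] i) (𝔽ᵣ.+-identityʳ _)

  -ₚ-cong : ∀ {p q} → p ≋ q → (-ₚ p) ≋ (-ₚ q)
  -ₚ-cong {p} {q} e = ext λ i →
    trans (coeff-neg p i) (trans (cong -_ (at e i)) (sym (coeff-neg q i)))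

  -ₚ-inverseʳ : ∀ p → (p +ₚ (-ₚ p)) ≋ []
  -ₚ-inverseʳ p = ext λ i → trans (coeff-+ p _ i)
    (trans (cong (coeff p i +_) (coeff-neg p i)) (𝔽ᵣ.-‿inverseʳ _))

  *ₚ-congˡ : ∀ p {q q′} → q ≋ q′ → (p *ₚ q) ≋ (p *ₚ q′)
  *ₚ-congˡ []      e = ≋-refl
  *ₚ-congˡ (a ∷ p) {q} {q′} e = ext λ where
    zero → trans (coeff-*-zero a p q)
      (trans (cong (a *_) (at e 0)) (sym (coeff-*-zero a p q′)))
    (suc i) → trans (coeff-*-suc a p q i)
      (trans (cong₂ _+_ (cong (a *_) (at e (suc i))) (at (*ₚ-congˡ p e) i))
        (sym (coeff-*-suc a p q′ i)))

  *ₚ-zeroʳ : ∀ p → (p *ₚ []) ≋ []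
  *ₚ-zeroʳ []      = ≋-refl
  *ₚ-zeroʳ (a ∷ p) = ext λ where
    zero → trans (coeff-*-zero a p []) (𝔽ᵣ.zeroʳ a)
    (suc i) → trans (coeff-*-suc a p [] i)
      (trans (cong₂ _+_ (𝔽ᵣ.zeroʳ a) (at (*ₚ-zeroʳ p) i)) 0+0≡0)

  -- The mirror image of the defining recursion of the product; commutativity is then an induction
  -- on the left factor.
  *ₚ-∷ʳ : ∀ p b q → (p *ₚ (b ∷ q)) ≋ (scale b p +ₚ (0# ∷ (p *ₚ q)))
  *ₚ-∷ʳ [] b q = ext λ { zero → refl ; (suc i) → refl }
  *ₚ-∷ʳ (a ∷ p) b q = ext λ where
    zero → begin
      coeff ((a ∷ p) *ₚ (b ∷ q)) 0  ≡⟨ coeff-*-zero a p (b ∷ q) ⟩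
      a * b                         ≡⟨ solve 2 (λ a b → a :* b := b :* a :+ con 0ℤ) refl a b ⟩
      b * a + 0#                    ∎
    (suc i) → begin
      coeff ((a ∷ p) *ₚ (b ∷ q)) (suc i)
        ≡⟨ coeff-*-suc a p (b ∷ q) i ⟩
      a * coeff q i + coeff (p *ₚ (b ∷ q)) i
        ≡⟨ cong (a * coeff q i +_) (at (*ₚ-∷ʳ p b q) i) ⟩
      a * coeff q i + coeff (scale b p +ₚ (0# ∷ (p *ₚ q))) i
        ≡⟨ cong (a * coeff q i +_) (coeff-+ (scale b p) _ i) ⟩
      a * coeff q i + (coeff (scale b p) i + coeff (0# ∷ (p *ₚ q)) i)
        ≡⟨ solve 3 (λ x y z → x :+ (y :+ z) := y :+ (x :+ z)) refl _ _ _ ⟩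
      coeff (scale b p) i + (a * coeff q i + coeff (0# ∷ (p *ₚ q)) i)
        ≡⟨ cong (λ z → coeff (scale b p) i + (z + coeff (0# ∷ (p *ₚ q)) i)) (coeff-scale a q i) ⟨
      coeff (scale b p) i + (coeff (scale a q) i + coeff (0# ∷ (p *ₚ q)) i)
        ≡⟨ cong (coeff (scale b p) i +_) (coeff-+ (scale a q) _ i) ⟨
      coeff (scale b p) i + coeff ((a ∷ p) *ₚ q) i
        ≡⟨ coeff-+ (scale b p) _ i ⟨
      coeff (scale b p +ₚ ((a ∷ p) *ₚ q)) i ∎

  *ₚ-comm : ∀ p q → (p *ₚ q) ≋ (q *ₚ p)
  *ₚ-comm []      q = ≋-sym (*ₚ-zeroʳ q)
  *ₚ-comm (a ∷ p) q = ≋-trans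
    (+ₚ-cong {scale a q} ≋-refl (∷-cong (*ₚ-comm p q)))
    (≋-sym (*ₚ-∷ʳ q a p))

  *ₚ-cong : ∀ {p p′ q q′} → p ≋ p′ → q ≋ q′ → (p *ₚ q) ≋ (p′ *ₚ q′)
  *ₚ-cong {p} {p′} {q} {q′} e e′ = ≋-trans (*ₚ-congˡ p e′)
    (≋-trans (*ₚ-comm p q′) (≋-trans (*ₚ-congˡ q′ e) (*ₚ-comm q′ p′)))

  *ₚ-distribˡ : ∀ p q r → (p *ₚ (q +ₚ r)) ≋ ((p *ₚ q) +ₚ (p *ₚ r))
  *ₚ-distribˡ []      q r = ≋-refl
  *ₚ-distribˡ (a ∷ p) q r = ext λ where
    zero → begin
      coeff ((a ∷ p) *ₚ (q +ₚ r)) 0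
        ≡⟨ trans (coeff-*-zero a p (q +ₚ r)) (cong (a *_) (coeff-+ q r 0)) ⟩
      a * (coeff q 0 + coeff r 0)
        ≡⟨ 𝔽ᵣ.distribˡ _ _ _ ⟩
      a * coeff q 0 + a * coeff r 0
        ≡⟨ trans (coeff-+ ((a ∷ p) *ₚ q) _ 0) (cong₂ _+_ (coeff-*-zero a p q) (coeff-*-zero a p r)) ⟨
      coeff (((a ∷ p) *ₚ q) +ₚ ((a ∷ p) *ₚ r)) 0 ∎
    (suc i) → begin
      coeff ((a ∷ p) *ₚ (q +ₚ r)) (suc i)
        ≡⟨ coeff-*-suc a p (q +ₚ r) i ⟩
      a * coeff (q +ₚ r) (suc i) + coeff (p *ₚ (q +ₚ r)) i
        ≡⟨ cong₂ (λ x y → a * x + y) (coeff-+ q r (suc i))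
             (trans (at (*ₚ-distribˡ p q r) i) (coeff-+ (p *ₚ q) _ i)) ⟩
      a * (coeff q (suc i) + coeff r (suc i)) + (coeff (p *ₚ q) i + coeff (p *ₚ r) i)
        ≡⟨ solve 5 (λ a x y z w → a :* (x :+ y) :+ (z :+ w) := (a :* x :+ z) :+ (a :* y :+ w))
             refl a _ _ _ _ ⟩
      (a * coeff q (suc i) + coeff (p *ₚ q) i) + (a * coeff r (suc i) + coeff (p *ₚ r) i)
        ≡⟨ trans (coeff-+ ((a ∷ p) *ₚ q) _ (suc i))
             (cong₂ _+_ (coeff-*-suc a p q i) (coeff-*-suc a p r i)) ⟨
      coeff (((a ∷ p) *ₚ q) +ₚ ((a ∷ p) *ₚ r)) (suc i) ∎

  *ₚ-distribʳ : ∀ p q r → ((q +ₚ r) *ₚ p) ≋ ((q *ₚ p) +ₚ (r *ₚ p))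
  *ₚ-distribʳ p q r = ≋-trans (*ₚ-comm (q +ₚ r) p)
    (≋-trans (*ₚ-distribˡ p q r) (+ₚ-cong (*ₚ-comm p q) (*ₚ-comm p r)))

  scale-* : ∀ a p q → (scale a p *ₚ q) ≋ scale a (p *ₚ q)
  scale-* a []      q = ≋-refl
  scale-* a (b ∷ p) q = ext λ where
    zero → begin
      coeff ((a * b ∷ scale a p) *ₚ q) 0  ≡⟨ coeff-*-zero (a * b) (scale a p) q ⟩
      a * b * coeff q 0                   ≡⟨ 𝔽ᵣ.*-assoc _ _ _ ⟩
      a * (b * coeff q 0)                 ≡⟨ cong (a *_) (coeff-*-zero b p q) ⟨
      a * coeff ((b ∷ p) *ₚ q) 0          ≡⟨ coeff-scale a ((b ∷ p) *ₚ q) 0 ⟨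
      coeff (scale a ((b ∷ p) *ₚ q)) 0    ∎
    (suc i) → begin
      coeff ((a * b ∷ scale a p) *ₚ q) (suc i)
        ≡⟨ coeff-*-suc (a * b) (scale a p) q i ⟩
      a * b * coeff q (suc i) + coeff (scale a p *ₚ q) i
        ≡⟨ cong (a * b * coeff q (suc i) +_) (trans (at (scale-* a p q) i) (coeff-scale a (p *ₚ q) i)) ⟩
      a * b * coeff q (suc i) + a * coeff (p *ₚ q) i
        ≡⟨ solve 4 (λ a b x y → a :* b :* x :+ a :* y := a :* (b :* x :+ y)) refl a b _ _ ⟩
      a * (b * coeff q (suc i) + coeff (p *ₚ q) i)
        ≡⟨ cong (a *_) (coeff-*-suc b p q i) ⟨
      a * coeff ((b ∷ p) *ₚ q) (suc i)
        ≡⟨ coeff-scale a ((b ∷ p) *ₚ q) (suc i) ⟨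
      coeff (scale a ((b ∷ p) *ₚ q)) (suc i) ∎

  shift-* : ∀ p q → ((0# ∷ p) *ₚ q) ≋ (0# ∷ (p *ₚ q))
  shift-* p q = ext λ where
    zero → trans (coeff-*-zero 0# p q) (𝔽ᵣ.zeroˡ _)
    (suc i) → trans (coeff-*-suc 0# p q i)
      (trans (cong (_+ coeff (p *ₚ q) i) (𝔽ᵣ.zeroˡ _)) (𝔽ᵣ.+-identityˡ _))

  *ₚ-assoc : ∀ p q r → ((p *ₚ q) *ₚ r) ≋ (p *ₚ (q *ₚ r))
  *ₚ-assoc []      q r = ≋-refl
  *ₚ-assoc (a ∷ p) q r = ≋-trans (*ₚ-distribʳ r (scale a q) _)
    (+ₚ-cong (scale-* a q r) (≋-trans (shift-* (p *ₚ q) r) (∷-cong (*ₚ-assoc p q r))))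

  *ₚ-identityˡ : ∀ p → (1ₚ *ₚ p) ≋ p
  *ₚ-identityˡ p = ext λ where
    zero → trans (coeff-*-zero 1# [] p) (𝔽ᵣ.*-identityˡ _)
    (suc i) → trans (coeff-*-suc 1# [] p i)
      (trans (𝔽ᵣ.+-identityʳ _) (𝔽ᵣ.*-identityˡ _))

  polyRing : CommutativeRing 0ℓ 0ℓ
  polyRing = record
    { Carrier = Poly ; _≈_ = _≋_ ; _+_ = _+ₚ_ ; _*_ = _*ₚ_ ; -_ = -ₚ_ ; 0# = 0ₚ ; 1# = 1ₚ
    ; isCommutativeRing = record
      { isRing = record
        { +-isAbelianGroup = record
          { isGroup = record
            { isMonoid = record
              { isSemigroup = record
                { isMagma = record
                  { isEquivalence = record { refl = ≋-refl ; sym = ≋-sym ; trans = ≋-trans }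
                  ; ∙-cong = +ₚ-cong }
                ; assoc = +ₚ-assoc }
              ; identity = (λ _ → ≋-refl) , +ₚ-identityʳ }
            ; inverse = (λ p → ≋-trans (+ₚ-comm (-ₚ p) p) (-ₚ-inverseʳ p)) , -ₚ-inverseʳ
            ; ⁻¹-cong = -ₚ-cong }
          ; comm = +ₚ-comm }
        ; *-cong = *ₚ-cong
        ; *-assoc = *ₚ-assoc
        ; *-identity = *ₚ-identityˡ , λ p → ≋-trans (*ₚ-comm p 1ₚ) (*ₚ-identityˡ p)
        ; distrib = *ₚ-distribˡ , *ₚ-distribʳ }
      ; *-comm = *ₚ-comm } }

  -- Degree bounds and division with remainder.

  DegLt : ℕ → Poly → Set
  DegLt d p = ∀ i → d ≤ i → coeff p i ≡ 0#

  Monic : ℕ → Poly → Set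
  Monic d p = coeff p d ≡ 1# × DegLt (suc d) p

  DegLt-+ : ∀ {d} p q → DegLt d p → DegLt d q → DegLt d (p +ₚ q)
  DegLt-+ p q y z i d≤i = trans (coeff-+ p q i) (trans (cong₂ _+_ (y i d≤i) (z i d≤i)) 0+0≡0)

  DegLt-neg : ∀ {d} p → DegLt d p → DegLt d (-ₚ p)
  DegLt-neg p z i d≤i = trans (coeff-neg p i) (trans (cong -_ (z i d≤i)) -0≡0)

  DegLt-scale : ∀ {d} a p → DegLt d p → DegLt d (scale a p)
  DegLt-scale a p z i d≤i = trans (coeff-scale a p i) (trans (cong (a *_) (z i d≤i)) (𝔽ᵣ.zeroʳ a))

  *ₚ-zeroˡ : ∀ {p} q → p ≋ [] → (p *ₚ q) ≋ []
  *ₚ-zeroˡ q e = *ₚ-cong {q = q} e ≋-refl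

  DegLt-* : ∀ a b p q → DegLt (suc a) p → DegLt (suc b) q → DegLt (suc (a ℕ.+ b)) (p *ₚ q)
  DegLt-* a b [] q y z i d≤i = refl
  DegLt-* zero b (x ∷ p) q y z (suc i) (s≤s b≤i) = trans (coeff-*-suc x p q i)
    (trans (cong₂ _+_ (trans (cong (x *_) (z (suc i) (s≤s b≤i))) (𝔽ᵣ.zeroʳ x))
      (at (*ₚ-zeroˡ {p} q (ext λ j → y (suc j) (s≤s z≤n))) i)) 0+0≡0)
  DegLt-* (suc a) b (x ∷ p) q y z (suc i) (s≤s d≤i) = trans (coeff-*-suc x p q i)
    (trans (cong₂ _+_
      (trans (cong (x *_) (z (suc i) (s≤s (ℕₚ.≤-trans (ℕₚ.m≤n+m b (suc a)) d≤i)))) (𝔽ᵣ.zeroʳ x))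
      (DegLt-* a b p q (λ j a<j → y (suc j) (s≤s a<j)) z i d≤i)) 0+0≡0)

  coeff-*-top : ∀ a b p q → DegLt (suc a) p → DegLt (suc b) q →
    coeff (p *ₚ q) (a ℕ.+ b) ≡ coeff p a * coeff q b
  coeff-*-top a b [] q y z = sym (𝔽ᵣ.zeroˡ _)
  coeff-*-top zero zero (x ∷ p) q y z = coeff-*-zero x p q
  coeff-*-top zero (suc b) (x ∷ p) q y z = trans (coeff-*-suc x p q b)
    (trans (cong (_ +_) (at (*ₚ-zeroˡ {p} q (ext λ j → y (suc j) (s≤s z≤n))) b)) (𝔽ᵣ.+-identityʳ _))
  coeff-*-top (suc a) b (x ∷ p) q y z = trans (coeff-*-suc x p q (a ℕ.+ b))
    (trans (cong₂ _+_
      (trans (cong (x *_) (z (suc (a ℕ.+ b)) (s≤s (ℕₚ.m≤n+m b a)))) (𝔽ᵣ.zeroʳ x))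
      (coeff-*-top a b p q (λ j a<j → y (suc j) (s≤s a<j)) z)) (𝔽ᵣ.+-identityˡ _))

  -- Trailing zeros make the length of a list useless as a degree, so the exact degree is searched
  -- for downwards from a bound.
  leading : ∀ d p → DegLt d p →
    p ≋ [] ⊎ ∃ λ e → e < d × coeff p e ≢ 0# × DegLt (suc e) p
  leading zero p z = inj₁ (ext λ i → z i z≤n)
  leading (suc d) p z with coeff p d ≟ 0#
  ... | no ≢0 = inj₂ (d , ℕₚ.≤-refl , ≢0 , z)
  ... | yes ≡0 with leading d p smaller
    where
    smaller : DegLt d p
    smaller i d≤i with ℕₚ.m≤n⇒m<n∨m≡n d≤i
    ... | inj₁ d<i  = z i d<i
    ... | inj₂ refl = ≡0
  ... | inj₁ e = inj₁ e
  ... | inj₂ (e , e<d , r) = inj₂ (e , ℕₚ.m<n⇒m<1+n e<d , r)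

  -- Long division in Horner form. If p = f s + r, then a + X p = f (X s) + (a + X r), and the only
  -- term of a + X r of degree d is removed by subtracting c f, where c is its coefficient.
  divide : ∀ {d} f → Monic d f → ∀ p → ∃₂ λ s r → p ≋ ((f *ₚ s) +ₚ r) × DegLt d r
  divide f monic [] = [] , [] , ≋-sym (≋-trans (+ₚ-identityʳ _) (*ₚ-zeroʳ f)) , λ _ _ → refl
  divide {d} f (lead , deg) (a ∷ p) with divide f (lead , deg) p
  ... | s , r , eq , small = c ∷ s , (a ∷ r) +ₚ (-ₚ scale c f) , ext eq′ , small′
    where
    c = coeff (a ∷ r) d
    coeff-rem : ∀ i → coeff ((a ∷ r) +ₚ (-ₚ scale c f)) i ≡ coeff (a ∷ r) i + - (c * coeff f i)
    coeff-rem i = trans (coeff-+ (a ∷ r) (-ₚ scale c f) i)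
      (cong (coeff (a ∷ r) i +_) (trans (coeff-neg (scale c f) i) (cong -_ (coeff-scale c f i))))
    small′ : DegLt d ((a ∷ r) +ₚ (-ₚ scale c f))
    small′ i d≤i with ℕₚ.m≤n⇒m<n∨m≡n d≤i
    ... | inj₂ refl = trans (coeff-rem d) (trans (cong (λ x → c + - (c * x)) lead)
            (solve 1 (λ c → c :+ (:- (c :* con 1ℤ)) := con 0ℤ) refl c))
    small′ (suc i) _ | inj₁ (s≤s d≤i) = trans (coeff-rem (suc i))
      (trans (cong₂ (λ x y → x + - (c * y)) (small i d≤i) (deg (suc i) (s≤s d≤i)))
        (solve 1 (λ c → con 0ℤ :+ (:- (c :* con 0ℤ)) := con 0ℤ) refl c))
    telescope : ∀ i {x} → x ≡ coeff (0# ∷ (f *ₚ s)) i + coeff (a ∷ r) i →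
      x ≡ coeff ((f *ₚ (c ∷ s)) +ₚ ((a ∷ r) +ₚ (-ₚ scale c f))) i
    telescope i {x} e = begin
      x
        ≡⟨ e ⟩
      coeff (0# ∷ (f *ₚ s)) i + coeff (a ∷ r) i
        ≡⟨ solve 3 (λ y z w → y :+ z := (w :+ y) :+ (z :- w)) refl _ _ (c * coeff f i) ⟩
      (c * coeff f i + coeff (0# ∷ (f *ₚ s)) i) + (coeff (a ∷ r) i + - (c * coeff f i))
        ≡⟨ cong₂ _+_ (trans (at (*ₚ-∷ʳ f c s) i)
             (trans (coeff-+ (scale c f) _ i) (cong (_+ coeff (0# ∷ (f *ₚ s)) i) (coeff-scale c f i))))
             (coeff-rem i) ⟨
      coeff (f *ₚ (c ∷ s)) i + coeff ((a ∷ r) +ₚ (-ₚ scale c f)) i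
        ≡⟨ coeff-+ (f *ₚ (c ∷ s)) _ i ⟨
      coeff ((f *ₚ (c ∷ s)) +ₚ ((a ∷ r) +ₚ (-ₚ scale c f))) i ∎
    eq′ : (a ∷ p) ≈ₚ ((f *ₚ (c ∷ s)) +ₚ ((a ∷ r) +ₚ (-ₚ scale c f)))
    eq′ zero    = telescope zero (sym (𝔽ᵣ.+-identityˡ a))
    eq′ (suc i) = telescope (suc i) (trans (at eq i) (coeff-+ (f *ₚ s) r i))

-- Vectors, linear maps and matrices over F.

lookup-ext : {A : Set} {k : ℕ} {v w : Vec A k} → (∀ i → lookup v i ≡ lookup w i) → v ≡ w
lookup-ext {v = v} {w} eq = trans (sym (Vecₚ.tabulate∘lookup v))
  (trans (Vecₚ.tabulate-cong eq) (Vecₚ.tabulate∘lookup w))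

module LinearAlgebra (𝔽 : FiniteField) where
  open FiniteField 𝔽 using (0#; 1#; _≟_)
  open FF 𝔽
  open Polynomials 𝔽
  open 𝔽ᵣ using (_+_; _*_; -_)
  open 𝔽ₛ using (solve; con; _:+_; _:*_; :-_; _:=_)
  open ≡-Reasoning

  infixl 6 _⊞_
  infixr 7 _•_ _∙_

  _⊞_ : ∀ {k} → Vec F k → Vec F k → Vec F k
  _⊞_ = zipWith _+_

  _•_ : ∀ {k} → F → Vec F k → Vec F k
  a • v = Vec.map (a *_) v

  ⊟_ : ∀ {k} → Vec F k → Vec F k
  ⊟ v = Vec.map -_ v

  𝟎 : ∀ {k} → Vec F k
  𝟎 = replicate _ 0#

  lookup-⊞ : ∀ {k} (v w : Vec F k) i → lookup (v ⊞ w) i ≡ lookup v i + lookup w i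
  lookup-⊞ v w i = Vecₚ.lookup-zipWith _+_ i v w

  lookup-• : ∀ {k} a (v : Vec F k) i → lookup (a • v) i ≡ a * lookup v i
  lookup-• a v i = Vecₚ.lookup-map i (a *_) v

  lookup-𝟎 : ∀ {k} (i : Fin k) → lookup 𝟎 i ≡ 0#
  lookup-𝟎 i = Vecₚ.lookup-replicate i 0#

  ⊞-identityˡ : ∀ {k} (v : Vec F k) → 𝟎 ⊞ v ≡ v
  ⊞-identityˡ = Vecₚ.zipWith-identityˡ 𝔽ᵣ.+-identityˡ

  ⊞-identityʳ : ∀ {k} (v : Vec F k) → v ⊞ 𝟎 ≡ v
  ⊞-identityʳ = Vecₚ.zipWith-identityʳ 𝔽ᵣ.+-identityʳ

  ⊞-inverseʳ : ∀ {k} (v : Vec F k) → v ⊞ (⊟ v) ≡ 𝟎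
  ⊞-inverseʳ []      = refl
  ⊞-inverseʳ (x ∷ v) = cong₂ _∷_ (𝔽ᵣ.-‿inverseʳ x) (⊞-inverseʳ v)

  ⊞-interchange : ∀ {k} (u v w x : Vec F k) → (u ⊞ v) ⊞ (w ⊞ x) ≡ (u ⊞ w) ⊞ (v ⊞ x)
  ⊞-interchange []      []      []      []      = refl
  ⊞-interchange (a ∷ u) (b ∷ v) (c ∷ w) (d ∷ x) = cong₂ _∷_
    (solve 4 (λ a b c d → (a :+ b) :+ (c :+ d) := (a :+ c) :+ (b :+ d)) refl a b c d)
    (⊞-interchange u v w x)

  ⊟-⊞ : ∀ {k} (v w : Vec F k) → ⊟ (v ⊞ w) ≡ (⊟ v) ⊞ (⊟ w)
  ⊟-⊞ []      []      = refl
  ⊟-⊞ (x ∷ v) (y ∷ w) = cong₂ _∷_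
    (solve 2 (λ x y → :- (x :+ y) := (:- x) :+ (:- y)) refl x y) (⊟-⊞ v w)

  ⊟-𝟎 : ∀ {k} → ⊟ 𝟎 {k} ≡ 𝟎
  ⊟-𝟎 {zero}  = refl
  ⊟-𝟎 {suc k} = cong₂ _∷_ -0≡0 ⊟-𝟎

  •-distribˡ : ∀ {k} a (v w : Vec F k) → a • (v ⊞ w) ≡ a • v ⊞ a • w
  •-distribˡ a []      []      = refl
  •-distribˡ a (x ∷ v) (y ∷ w) = cong₂ _∷_ (𝔽ᵣ.distribˡ a x y) (•-distribˡ a v w)

  •-distribʳ : ∀ {k} a b (v : Vec F k) → (a + b) • v ≡ a • v ⊞ b • v
  •-distribʳ a b []      = refl
  •-distribʳ a b (x ∷ v) = cong₂ _∷_ (𝔽ᵣ.distribʳ x a b) (•-distribʳ a b v)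

  •-assoc : ∀ {k} a b (v : Vec F k) → (a * b) • v ≡ a • b • v
  •-assoc a b []      = refl
  •-assoc a b (x ∷ v) = cong₂ _∷_ (𝔽ᵣ.*-assoc a b x) (•-assoc a b v)

  •-comm : ∀ {k} a b (v : Vec F k) → a • b • v ≡ b • a • v
  •-comm a b v = trans (sym (•-assoc a b v))
    (trans (cong (_• v) (𝔽ᵣ.*-comm a b)) (•-assoc b a v))

  1• : ∀ {k} (v : Vec F k) → 1# • v ≡ v
  1• []      = refl
  1• (x ∷ v) = cong₂ _∷_ (𝔽ᵣ.*-identityˡ x) (1• v)

  0• : ∀ {k} (v : Vec F k) → 0# • v ≡ 𝟎
  0• []      = refl
  0• (x ∷ v) = cong₂ _∷_ (𝔽ᵣ.zeroˡ x) (0• v)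

  •-𝟎 : ∀ {k} a → a • 𝟎 {k} ≡ 𝟎
  •-𝟎 {zero}  a = refl
  •-𝟎 {suc k} a = cong₂ _∷_ (𝔽ᵣ.zeroʳ a) (•-𝟎 a)

  neg-• : ∀ {k} a (v : Vec F k) → (- a) • v ≡ ⊟ (a • v)
  neg-• a []      = refl
  neg-• a (x ∷ v) = cong₂ _∷_ (solve 2 (λ a x → (:- a) :* x := :- (a :* x)) refl a x) (neg-• a v)

  infix 4 _≟ᵥ_
  _≟ᵥ_ : ∀ {k} (v w : Vec F k) → Dec (v ≡ w)
  _≟ᵥ_ = Vecₚ.≡-dec _≟_

  record Linear {k l} (φ : Vec F k → Vec F l) : Set where
    field
      +-hom : ∀ v w → φ (v ⊞ w) ≡ φ v ⊞ φ w
      •-hom : ∀ a v → φ (a • v) ≡ a • φ v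

    0-hom : φ 𝟎 ≡ 𝟎
    0-hom = trans (cong φ (sym (0• 𝟎))) (trans (•-hom 0# 𝟎) (0• _))
  open Linear public

  Linear-∘ : ∀ {k l n} {φ : Vec F l → Vec F n} {ψ : Vec F k → Vec F l} →
    Linear φ → Linear ψ → Linear (φ ∘ ψ)
  Linear-∘ {φ = φ} L M = record
    { +-hom = λ v w → trans (cong φ (+-hom M v w)) (+-hom L _ _)
    ; •-hom = λ a v → trans (cong φ (•-hom M a v)) (•-hom L a _) }

  Linear-id : ∀ {k} → Linear {k} id
  Linear-id = record { +-hom = λ _ _ → refl ; •-hom = λ _ _ → refl }

  sum-cong : ∀ {k} {f g : Fin k → F} → (∀ i → f i ≡ g i) → sumF f ≡ sumF g
  sum-cong {zero}  eq = refl
  sum-cong {suc k} eq = cong₂ _+_ (eq zero) (sum-cong (eq ∘ suc))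

  sum-0 : ∀ {k} {f : Fin k → F} → (∀ i → f i ≡ 0#) → sumF f ≡ 0#
  sum-0 {zero}  eq = refl
  sum-0 {suc k} eq = trans (cong₂ _+_ (eq zero) (sum-0 (eq ∘ suc))) 0+0≡0

  sum-+ : ∀ {k} (f g : Fin k → F) → sumF (λ i → f i + g i) ≡ sumF f + sumF g
  sum-+ {zero}  f g = sym 0+0≡0
  sum-+ {suc k} f g = trans (cong (f zero + g zero +_) (sum-+ (f ∘ suc) (g ∘ suc)))
    (solve 4 (λ a b c d → (a :+ b) :+ (c :+ d) := (a :+ c) :+ (b :+ d)) refl _ _ _ _)

  sum-* : ∀ {k} a (f : Fin k → F) → sumF (λ i → a * f i) ≡ a * sumF f
  sum-* {zero}  a f = sym (𝔽ᵣ.zeroʳ a)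
  sum-* {suc k} a f = trans (cong (a * f zero +_) (sum-* a (f ∘ suc))) (sym (𝔽ᵣ.distribˡ a _ _))

  sum-single : ∀ {k} (f : Fin k → F) j → (∀ i → i ≢ j → f i ≡ 0#) → sumF f ≡ f j
  sum-single f zero z = trans (cong (f zero +_) (sum-0 (λ i → z (suc i) λ ())))
    (𝔽ᵣ.+-identityʳ _)
  sum-single f (suc j) z = trans
    (cong₂ _+_ (z zero λ ()) (sum-single (f ∘ suc) j (λ i i≢j → z (suc i) (i≢j ∘ Finₚ.suc-injective))))
    (𝔽ᵣ.+-identityˡ _)

  δ-refl : ∀ {k} (i : Fin k) → δ i i ≡ 1#
  δ-refl i with i Fin.≟ i
  ... | yes _ = refl
  ... | no i≢i = contradiction refl i≢i

  δ-≢ : ∀ {k} {i j : Fin k} → i ≢ j → δ i j ≡ 0#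
  δ-≢ {i = i} {j} i≢j with i Fin.≟ j
  ... | yes i≡j = contradiction i≡j i≢j
  ... | no _ = refl

  δ-suc : ∀ {k} (i j : Fin k) → δ (suc i) (suc j) ≡ δ i j
  δ-suc i j with i Fin.≟ j
  ... | yes _ = refl
  ... | no _ = refl

  sum-δʳ : ∀ {k} (f : Fin k → F) j → sumF (λ i → f i * δ i j) ≡ f j
  sum-δʳ f j = trans
    (sum-single _ j (λ i i≢j → trans (cong (f i *_) (δ-≢ i≢j)) (𝔽ᵣ.zeroʳ _)))
    (trans (cong (f j *_) (δ-refl j)) (𝔽ᵣ.*-identityʳ _))

  sum-δˡ : ∀ {k} (f : Fin k → F) j → sumF (λ i → δ j i * f i) ≡ f j
  sum-δˡ f j = trans
    (sum-single _ j (λ i i≢j → trans (cong (_* f i) (δ-≢ (i≢j ∘ sym))) (𝔽ᵣ.zeroˡ _)))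
    (trans (cong (_* f j) (δ-refl j)) (𝔽ᵣ.*-identityˡ _))

  unit : ∀ {k} → Fin k → Vec F k
  unit j = tabulate λ i → δ i j

  lookup-unit : ∀ {k} (i j : Fin k) → lookup (unit j) i ≡ δ i j
  lookup-unit i j = Vecₚ.lookup∘tabulate _ i

  linear-ext : ∀ {k l} {φ ψ : Vec F k → Vec F l} → Linear φ → Linear ψ →
    (∀ j → φ (unit j) ≡ ψ (unit j)) → ∀ v → φ v ≡ ψ v
  linear-ext {zero} L M eq [] = trans (0-hom L) (sym (0-hom M))
  linear-ext {suc k} {φ = φ} {ψ} L M eq (x ∷ v) = begin
    φ (x ∷ v)                          ≡⟨ cong φ split ⟩
    φ (x • unit zero ⊞ (0# ∷ v))       ≡⟨ +-hom L _ _ ⟩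
    φ (x • unit zero) ⊞ φ (0# ∷ v)     ≡⟨ cong₂ _⊞_ head tail ⟩
    ψ (x • unit zero) ⊞ ψ (0# ∷ v)     ≡⟨ +-hom M _ _ ⟨
    ψ (x • unit zero ⊞ (0# ∷ v))       ≡⟨ cong ψ split ⟨
    ψ (x ∷ v)                          ∎
    where
    tail-unit : ∀ {j} → lookup (unit (zero {k})) (suc j) ≡ 0#
    tail-unit {j} = lookup-unit (suc j) zero
    split : (x ∷ v) ≡ x • unit zero ⊞ (0# ∷ v)
    split = lookup-ext λ where
      zero    → solve 1 (λ x → x := x :* con 1ℤ :+ con 0ℤ) refl x
      (suc j) → sym (trans (lookup-⊞ (x • unit zero) (0# ∷ v) (suc j))
        (trans (cong (_+ lookup v j) (trans (lookup-• x (unit zero) (suc j))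
          (trans (cong (x *_) tail-unit) (𝔽ᵣ.zeroʳ x)))) (𝔽ᵣ.+-identityˡ _)))
    head : φ (x • unit zero) ≡ ψ (x • unit zero)
    head = trans (•-hom L x _) (trans (cong (x •_) (eq zero)) (sym (•-hom M x _)))
    prepend : Linear {k} (0# ∷_)
    prepend = record
      { +-hom = λ v w → cong (_∷ (v ⊞ w)) (sym 0+0≡0)
      ; •-hom = λ a v → cong (_∷ (a • v)) (sym (𝔽ᵣ.zeroʳ a)) }
    prepend-unit : ∀ j → 0# ∷ unit j ≡ unit (suc j)
    prepend-unit j = cong (0# ∷_) (Vecₚ.tabulate-cong (λ i → sym (δ-suc i j)))
    tail : φ (0# ∷ v) ≡ ψ (0# ∷ v)
    tail = linear-ext (Linear-∘ L prepend) (Linear-∘ M prepend)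
      (λ j → trans (cong φ (prepend-unit j)) (trans (eq (suc j)) (cong ψ (sym (prepend-unit j))))) v

  abstract
    _∙_ : ∀ {k} → Matrix F k → Vec F k → Vec F k
    M ∙ v = tabulate λ i → sumF λ j → entry M i j * lookup v j

    lookup-∙ : ∀ {k} (M : Matrix F k) v i →
      lookup (M ∙ v) i ≡ sumF (λ j → entry M i j * lookup v j)
    lookup-∙ M v i = Vecₚ.lookup∘tabulate _ i

  ∙-linear : ∀ {k} (M : Matrix F k) → Linear (M ∙_)
  ∙-linear M = record
    { +-hom = λ v w → lookup-ext λ i → begin
        lookup (M ∙ (v ⊞ w)) i
          ≡⟨ lookup-∙ M (v ⊞ w) i ⟩
        sumF (λ j → entry M i j * lookup (v ⊞ w) j)
          ≡⟨ sum-cong (λ j → trans (cong (entry M i j *_) (lookup-⊞ v w j)) (𝔽ᵣ.distribˡ _ _ _)) ⟩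
        sumF (λ j → entry M i j * lookup v j + entry M i j * lookup w j)
          ≡⟨ sum-+ (λ j → entry M i j * lookup v j) (λ j → entry M i j * lookup w j) ⟩
        sumF (λ j → entry M i j * lookup v j) + sumF (λ j → entry M i j * lookup w j)
          ≡⟨ cong₂ _+_ (lookup-∙ M v i) (lookup-∙ M w i) ⟨
        lookup (M ∙ v) i + lookup (M ∙ w) i
          ≡⟨ lookup-⊞ (M ∙ v) (M ∙ w) i ⟨
        lookup (M ∙ v ⊞ M ∙ w) i ∎
    ; •-hom = λ a v → lookup-ext λ i → begin
        lookup (M ∙ (a • v)) i
          ≡⟨ lookup-∙ M (a • v) i ⟩
        sumF (λ j → entry M i j * lookup (a • v) j)
          ≡⟨ sum-cong (λ j → trans (cong (entry M i j *_) (lookup-• a v j))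
               (solve 3 (λ m a x → m :* (a :* x) := a :* (m :* x)) refl (entry M i j) a (lookup v j))) ⟩
        sumF (λ j → a * (entry M i j * lookup v j))
          ≡⟨ sum-* a (λ j → entry M i j * lookup v j) ⟩
        a * sumF (λ j → entry M i j * lookup v j)
          ≡⟨ cong (a *_) (lookup-∙ M v i) ⟨
        a * lookup (M ∙ v) i
          ≡⟨ lookup-• a (M ∙ v) i ⟨
        lookup (a • M ∙ v) i ∎ }

  lookup-∙-unit : ∀ {k} (M : Matrix F k) i j → lookup (M ∙ unit j) i ≡ entry M i j
  lookup-∙-unit M i j = trans (lookup-∙ M (unit j) i)
    (trans (sum-cong (λ l → cong (entry M i l *_) (lookup-unit l j))) (sum-δʳ (entry M i) j))

  ∙-injective : ∀ {k} {M N : Matrix F k} → (∀ v → M ∙ v ≡ N ∙ v) → M ≡ N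
  ∙-injective {M = M} {N} eq = lookup-ext λ i → lookup-ext λ j →
    trans (sym (lookup-∙-unit M i j)) (trans (cong (λ v → lookup v i) (eq (unit j))) (lookup-∙-unit N i j))

  entry-tabulate : ∀ {A : Set} {k} (f : Fin k → Fin k → A) i j →
    entry (tabulate λ i → tabulate (f i)) i j ≡ f i j
  entry-tabulate f i j = trans (cong (λ r → lookup r j) (Vecₚ.lookup∘tabulate _ i))
    (Vecₚ.lookup∘tabulate (f i) j)

  matrixOf : ∀ {k} → (Vec F k → Vec F k) → Matrix F k
  matrixOf φ = tabulate λ i → tabulate λ j → lookup (φ (unit j)) i

  matrixOf-∙ : ∀ {k} {φ : Vec F k → Vec F k} → Linear φ → ∀ v → matrixOf φ ∙ v ≡ φ v
  matrixOf-∙ {φ = φ} L = linear-ext (∙-linear (matrixOf φ)) L λ j → lookup-ext λ i →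
    trans (lookup-∙-unit (matrixOf φ) i j) (entry-tabulate _ i j)

  ·-∙ : ∀ {k} (M N : Matrix F k) v → (M · N) ∙ v ≡ M ∙ N ∙ v
  ·-∙ M N = linear-ext (∙-linear (M · N)) (Linear-∘ (∙-linear M) (∙-linear N)) λ j → lookup-ext λ i → begin
    lookup ((M · N) ∙ unit j) i                          ≡⟨ lookup-∙-unit (M · N) i j ⟩
    entry (M · N) i j                                    ≡⟨ entry-tabulate _ i j ⟩
    sumF (λ l → entry M i l * entry N l j)               ≡⟨ sum-cong (λ l → cong (entry M i l *_) (lookup-∙-unit N l j)) ⟨
    sumF (λ l → entry M i l * lookup (N ∙ unit j) l)     ≡⟨ lookup-∙ M (N ∙ unit j) i ⟨
    lookup (M ∙ N ∙ unit j) i                            ∎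

  idMat-∙ : ∀ {k} (v : Vec F k) → idMat ∙ v ≡ v
  idMat-∙ = linear-ext (∙-linear idMat) Linear-id λ j → lookup-ext λ i →
    trans (lookup-∙-unit idMat i j) (trans (entry-tabulate δ i j) (sym (lookup-unit i j)))

  -- The F[X]-module in which X acts as a given operator.

  module Action {k : ℕ} (T : Vec F k → Vec F k) (T-linear : Linear T) where

    act : Poly → Vec F k → Vec F k
    act []      v = 𝟎
    act (a ∷ p) v = a • v ⊞ T (act p v)

    act-≋[] : ∀ {p} → p ≋ [] → ∀ v → act p v ≡ 𝟎
    act-≋[] {[]}    e v = refl
    act-≋[] {a ∷ p} e v = trans
      (cong₂ _⊞_ (trans (cong (_• v) (at e 0)) (0• v))
        (trans (cong T (act-≋[] {p} (ext λ i → at e (suc i)) v)) (0-hom T-linear)))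
      (⊞-identityˡ 𝟎)

    act-cong : ∀ {p q} → p ≋ q → ∀ v → act p v ≡ act q v
    act-cong {[]}    {q}     e v = sym (act-≋[] {q} (≋-sym e) v)
    act-cong {a ∷ p} {[]}    e v = act-≋[] {a ∷ p} e v
    act-cong {a ∷ p} {b ∷ q} e v = cong₂ _⊞_ (cong (_• v) (at e 0))
      (cong T (act-cong {p} {q} (ext λ i → at e (suc i)) v))

    act-+ : ∀ p q v → act (p +ₚ q) v ≡ act p v ⊞ act q v
    act-+ []      q       v = sym (⊞-identityˡ _)
    act-+ (a ∷ p) []      v = sym (⊞-identityʳ _)
    act-+ (a ∷ p) (b ∷ q) v = trans
      (cong₂ _⊞_ (•-distribʳ a b v) (trans (cong T (act-+ p q v)) (+-hom T-linear _ _)))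
      (⊞-interchange _ _ _ _)

    act-scale : ∀ a p v → act (scale a p) v ≡ a • act p v
    act-scale a []      v = sym (•-𝟎 a)
    act-scale a (b ∷ p) v = trans
      (cong₂ _⊞_ (•-assoc a b v) (trans (cong T (act-scale a p v)) (•-hom T-linear a _)))
      (sym (•-distribˡ a _ _))

    act-neg : ∀ p v → act (-ₚ p) v ≡ ⊟ act p v
    act-neg []      v = sym ⊟-𝟎
    act-neg (a ∷ p) v = trans
      (cong₂ _⊞_ (neg-• a v) (trans (cong T (act-neg p v)) T-⊟))
      (sym (⊟-⊞ _ _))
      where
      T-⊟ : T (⊟ act p v) ≡ ⊟ T (act p v)
      T-⊟ = begin
        T (⊟ act p v)             ≡⟨ cong (λ w → T (⊟ w)) (1• _) ⟨
        T (⊟ (1# • act p v))      ≡⟨ cong T (neg-• 1# _) ⟨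
        T ((- 1#) • act p v)      ≡⟨ •-hom T-linear (- 1#) _ ⟩
        (- 1#) • T (act p v)      ≡⟨ neg-• 1# _ ⟩
        ⊟ (1# • T (act p v))      ≡⟨ cong ⊟_ (1• _) ⟩
        ⊟ T (act p v)             ∎

    act-linear : ∀ p → Linear (act p)
    act-linear [] = record
      { +-hom = λ _ _ → sym (⊞-identityˡ 𝟎) ; •-hom = λ a _ → sym (•-𝟎 a) }
    act-linear (a ∷ p) = record
      { +-hom = λ v w → trans
          (cong₂ _⊞_ (•-distribˡ a v w) (trans (cong T (+-hom (act-linear p) v w)) (+-hom T-linear _ _)))
          (⊞-interchange _ _ _ _)
      ; •-hom = λ b v → trans
          (cong₂ _⊞_ (•-comm a b v) (trans (cong T (•-hom (act-linear p) b v)) (•-hom T-linear b _)))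
          (sym (•-distribˡ b _ _)) }

    act-* : ∀ p q v → act (p *ₚ q) v ≡ act p (act q v)
    act-* []      q v = refl
    act-* (a ∷ p) q v = trans (act-+ (scale a q) (0# ∷ (p *ₚ q)) v)
      (cong₂ _⊞_ (act-scale a q v)
        (trans (cong₂ _⊞_ (0• v) (cong T (act-* p q v))) (⊞-identityˡ _)))

    act-comm : ∀ p q v → act p (act q v) ≡ act q (act p v)
    act-comm p q v = trans (sym (act-* p q v))
      (trans (act-cong (*ₚ-comm p q) v) (act-* q p v))

    act-1 : ∀ v → act 1ₚ v ≡ v
    act-1 v = trans (cong₂ _⊞_ (1• v) (0-hom T-linear)) (⊞-identityʳ v)

  -- A linear map that commutes with the action of X is F[X]-linear.
  act-intertwine : ∀ {k l}
    {T : Vec F k → Vec F k} (T-linear : Linear T) {S : Vec F l → Vec F l} (S-linear : Linear S)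
    {φ : Vec F k → Vec F l} → Linear φ → (∀ v → φ (T v) ≡ S (φ v)) →
    ∀ p v → φ (Action.act T T-linear p v) ≡ Action.act S S-linear p (φ v)
  act-intertwine TL SL φL eq []      v = 0-hom φL
  act-intertwine TL {S} SL φL eq (a ∷ p) v = trans (+-hom φL _ _)
    (cong₂ _⊞_ (•-hom φL a v) (trans (eq _) (cong S (act-intertwine TL SL φL eq p v))))

-- Determinants as iterated contractions.

removeAt-map : {A B : Set} (f : A → B) {k : ℕ} (xs : Vec A (suc k)) (j : Fin (suc k)) →
  removeAt (Vec.map f xs) j ≡ Vec.map f (removeAt xs j)
removeAt-map f (x ∷ xs)       zero    = refl
removeAt-map f (x ∷ y ∷ xs) (suc j) = cong (f x ∷_) (removeAt-map f (y ∷ xs) j)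

module CayleyHamilton (𝔽 : FiniteField) where
  open FiniteField 𝔽 using (0#; 1#)
  open FF 𝔽
  open Polynomials 𝔽
  open LinearAlgebra 𝔽
  open 𝔽ᵣ using (_+_; _*_; -_)
  open 𝔽ₛ using (solve; con; _:+_; _:*_; :-_; _:=_)
  module Pₛ = IntegerSolver polyRing

  module _ {C : Set} where

    -- Contraction by the functional r: with D alternating, this is Laplace
    -- expansion along r of a determinant whose columns are listed.
    contract : (C → Poly) → (List C → Poly) → List C → Poly
    contract r D []       = []
    contract r D (c ∷ cs) = (r c *ₚ D cs) +ₚ (-ₚ contract r (λ ds → D (c ∷ ds)) cs)

    -- The determinant, when there are as many columns as rows. It is defined on all lists of
    -- columns because inductions on `contract` pass to functions such as `λ ds → D (c ∷ ds)`.
    minor : List (C → Poly) → List C → Poly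
    minor []       cs = 1ₚ
    minor (r ∷ rs) cs = contract r (minor rs) cs

    contract-cong : ∀ r {D E} → (∀ cs → D cs ≋ E cs) → ∀ cs → contract r D cs ≋ contract r E cs
    contract-cong r eq []       = ≋-refl
    contract-cong r eq (c ∷ cs) = +ₚ-cong (*ₚ-congˡ (r c) (eq cs))
      (-ₚ-cong (contract-cong r (λ ds → eq (c ∷ ds)) cs))

    -- Linearity in D, in the very shape to which an inner contraction unfolds at a first column.
    contract-combine : ∀ r a D E cs →
      contract r (λ ds → (a *ₚ D ds) +ₚ (-ₚ E ds)) cs ≋ ((a *ₚ contract r D cs) +ₚ (-ₚ contract r E cs))
    contract-combine r a D E []       = ≋-sym (≋-trans (+ₚ-identityʳ _) (*ₚ-zeroʳ a))
    contract-combine r a D E (c ∷ cs) = ≋-trans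
      (+ₚ-cong {r c *ₚ ((a *ₚ D cs) +ₚ (-ₚ E cs))} ≋-refl (-ₚ-cong (contract-combine r a (λ ds → D (c ∷ ds)) (λ ds → E (c ∷ ds)) cs)))
      (Pₛ.solve 6 (λ x a d e y z →
          x Pₛ.:* (a Pₛ.:* d Pₛ.:- e) Pₛ.:- (a Pₛ.:* y Pₛ.:- z)
          Pₛ.:= a Pₛ.:* (x Pₛ.:* d Pₛ.:- y) Pₛ.:- (x Pₛ.:* e Pₛ.:- z))
        ≋-refl (r c) a (D cs) (E cs) _ _)

    contract-scale : ∀ r a D cs → contract r (λ ds → a *ₚ D ds) cs ≋ (a *ₚ contract r D cs)
    contract-scale r a D []       = ≋-sym (*ₚ-zeroʳ a)
    contract-scale r a D (c ∷ cs) = ≋-trans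
      (+ₚ-cong {r c *ₚ (a *ₚ D cs)} ≋-refl (-ₚ-cong (contract-scale r a (λ ds → D (c ∷ ds)) cs)))
      (Pₛ.solve 4 (λ x a d y → x Pₛ.:* (a Pₛ.:* d) Pₛ.:- a Pₛ.:* y Pₛ.:= a Pₛ.:* (x Pₛ.:* d Pₛ.:- y))
        ≋-refl (r c) a (D cs) _)

    contract-0 : ∀ r {D} → (∀ cs → D cs ≋ []) → ∀ cs → contract r D cs ≋ []
    contract-0 r z []       = ≋-refl
    contract-0 r z (c ∷ cs) = +ₚ-cong (≋-trans (*ₚ-congˡ (r c) (z cs)) (*ₚ-zeroʳ (r c)))
      (-ₚ-cong (contract-0 r (λ ds → z (c ∷ ds)) cs))

    -- The anticommutation of interior products. Unfolding both contractions at the first column c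
    -- gives one term with the factor `r c` and one with `s c`, of opposite signs; exchanging r and
    -- s exchanges them, and the remaining double contraction is the induction hypothesis.
    contract-anticomm : ∀ r s D cs →
      contract r (contract s D) cs ≋ (-ₚ contract s (contract r D) cs)
    contract-anticomm r s D []       = ≋-refl
    contract-anticomm r s D (c ∷ cs) = ≋-trans
      (expand r s)
      (≋-trans
        (+ₚ-cong {r c *ₚ contract s D cs} ≋-refl (-ₚ-cong (+ₚ-cong {s c *ₚ contract r D cs} ≋-refl
          (-ₚ-cong (contract-anticomm r s (λ ds → D (c ∷ ds)) cs)))))
        (≋-trans
          (Pₛ.solve 3 (λ x y z → x Pₛ.:- (y Pₛ.:- (Pₛ.:- z)) Pₛ.:= Pₛ.:- (y Pₛ.:- (x Pₛ.:- z)))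
            ≋-refl (r c *ₚ contract s D cs) (s c *ₚ contract r D cs) _)
          (-ₚ-cong (≋-sym (expand s r)))))
      where
      expand : ∀ r s → contract r (contract s D) (c ∷ cs) ≋
        ((r c *ₚ contract s D cs) +ₚ (-ₚ ((s c *ₚ contract r D cs) +ₚ
          (-ₚ contract r (contract s (λ ds → D (c ∷ ds))) cs))))
      expand r s = +ₚ-cong {r c *ₚ contract s D cs} ≋-refl
        (-ₚ-cong (contract-combine r (s c) D (contract s (λ ds → D (c ∷ ds))) cs))

    -- A separate induction: anticommutativity shows only that twice the value vanishes, which
    -- leaves characteristic 2 open.
    contract-square : ∀ r D cs → contract r (contract r D) cs ≋ []
    contract-square r D []       = ≋-refl
    contract-square r D (c ∷ cs) = ≋-trans
      (+ₚ-cong {r c *ₚ contract r D cs} ≋-refl (-ₚ-cong (≋-trans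
        (contract-combine r (r c) D (contract r (λ ds → D (c ∷ ds))) cs)
        (≋-trans (+ₚ-cong {r c *ₚ contract r D cs} ≋-refl
          (-ₚ-cong (contract-square r (λ ds → D (c ∷ ds)) cs))) (+ₚ-identityʳ _)))))
      (-ₚ-inverseʳ (r c *ₚ contract r D cs))

    -- The contraction by r is moved past the other rows until it meets its own copy.
    repeated-row : ∀ {r rs} → r ∈ rs → ∀ cs → contract r (minor rs) cs ≋ []
    repeated-row {r} {s ∷ rs} (here refl) cs = contract-square r (minor rs) cs
    repeated-row {r} {s ∷ rs} (there r∈rs) cs = ≋-trans (contract-anticomm r s (minor rs) cs)
      (-ₚ-cong (contract-0 s (repeated-row r∈rs) cs))

    -- The multiplier ε is the sign of moving r past `rs`. Its value is left open, since a factor in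
    -- front does no harm when the rest annihilates a vector.
    row-to-front : ∀ rs r ss → Σ Poly λ ε → ∀ cs →
      minor (rs ++ r ∷ ss) cs ≋ (ε *ₚ contract r (minor (rs ++ ss)) cs)
    row-to-front []       r ss = 1ₚ , λ cs → ≋-sym (*ₚ-identityˡ _)
    row-to-front (s ∷ rs) r ss with row-to-front rs r ss
    ... | ε , eq = -ₚ ε , λ cs → ≋-trans (contract-cong s eq cs)
      (≋-trans (contract-scale s ε (contract r (minor (rs ++ ss))) cs)
        (≋-trans (*ₚ-congˡ ε (contract-anticomm s r (minor (rs ++ ss)) cs))
          (Pₛ.solve 2 (λ x y → x Pₛ.:* (Pₛ.:- y) Pₛ.:= (Pₛ.:- x) Pₛ.:* y) ≋-refl ε _)))

    open Det _+ₚ_ _*ₚ_ -ₚ_ 0ₚ 1ₚ using (altSum)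

    -- Bridge from the given determinant, which deletes columns by their index, to contractions,
    -- which take columns off the front of a list.
    altSum-contract : ∀ {k} r (cs : Vec C (suc k)) {G : Vec C k → Poly} {D : List C → Poly} →
      (∀ ds → G ds ≡ D (toList ds)) →
      altSum (tabulate λ j → lookup (Vec.map r cs) j *ₚ G (removeAt cs j)) ≡ contract r D (toList cs)
    altSum-contract r (c ∷ []) eq = cong (λ x → (r c *ₚ x) +ₚ []) (eq [])
    altSum-contract r (c ∷ cs@(_ ∷ _)) {D = D} eq = cong₂ (λ x y → (r c *ₚ x) +ₚ (-ₚ y)) (eq cs)
      (altSum-contract r cs {D = λ ds → D (c ∷ ds)} (λ ds → eq (c ∷ ds)))

    detₚ-minor : ∀ {k} {I : Set} (A : I → C → Poly) (is : Vec I k) (cs : Vec C k) →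
      detₚ (Vec.map (λ i → Vec.map (A i) cs) is) ≡ minor (List.map A (toList is)) (toList cs)
    detₚ-minor A []       []  = refl
    detₚ-minor A (i ∷ is) cs = trans
      (cong altSum (Vecₚ.tabulate-cong λ j → cong (λ M → lookup (Vec.map (A i) cs) j *ₚ detₚ M) (begin
        Vec.map (λ row → removeAt row j) (Vec.map (λ i → Vec.map (A i) cs) is)
          ≡⟨ Vecₚ.map-∘ _ _ is ⟨
        Vec.map (λ i → removeAt (Vec.map (A i) cs) j) is
          ≡⟨ Vecₚ.map-cong (λ i → removeAt-map (A i) cs j) is ⟩
        Vec.map (λ i → Vec.map (A i) (removeAt cs j)) is ∎)))
      (altSum-contract (A i) cs (detₚ-minor A is))
      where open ≡-Reasoning

    DegLt-contract : ∀ {d} r D → (∀ c → DegLt 2 (r c)) → (∀ cs → DegLt (suc d) (D cs)) →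
      ∀ cs → DegLt (suc (suc d)) (contract r D cs)
    DegLt-contract r D y z []       = λ _ _ → refl
    DegLt-contract r D y z (c ∷ cs) = DegLt-+ (r c *ₚ D cs) _ (DegLt-* 1 _ (r c) (D cs) (y c) (z cs))
      (DegLt-neg (contract r (λ ds → D (c ∷ ds)) cs) (DegLt-contract r (λ ds → D (c ∷ ds)) y (λ ds → z (c ∷ ds)) cs))

    DegLt-minor : ∀ rs → All (λ r → ∀ c → DegLt 2 (r c)) rs →
      ∀ cs → DegLt (suc (length rs)) (minor rs cs)
    DegLt-minor []       _        cs (suc i) (s≤s _) = refl
    DegLt-minor (r ∷ rs) (y ∷ ys) cs = DegLt-contract r (minor rs) y (DegLt-minor rs ys) cs

    coeff-contract-0 : ∀ {d} r D → (∀ c → DegLt 2 (r c)) → (∀ cs → DegLt (suc d) (D cs)) →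
      ∀ {cs} → All (λ c → coeff (r c) 1 ≡ 0#) cs → coeff (contract r D cs) (suc d) ≡ 0#
    coeff-contract-0 r D y z [] = refl
    coeff-contract-0 {d} r D y z {c ∷ cs} (e ∷ es) = begin
      coeff (contract r D (c ∷ cs)) (suc d)
        ≡⟨ coeff-+ (r c *ₚ D cs) _ (suc d) ⟩
      coeff (r c *ₚ D cs) (suc d) + coeff (-ₚ contract r (λ ds → D (c ∷ ds)) cs) (suc d)
        ≡⟨ cong₂ _+_ (trans (coeff-*-top 1 d (r c) (D cs) (y c) (z cs)) (trans (cong (_* _) e) (𝔽ᵣ.zeroˡ _)))
            (trans (coeff-neg (contract r (λ ds → D (c ∷ ds)) cs) (suc d))
              (trans (cong -_ (coeff-contract-0 r (λ ds → D (c ∷ ds)) y (λ ds → z (c ∷ ds)) es)) -0≡0)) ⟩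
      0# + 0#
        ≡⟨ 0+0≡0 ⟩
      0# ∎
      where open ≡-Reasoning

  -- Only the diagonal reaches the top degree: in the expansion along the first row, every entry
  -- after the diagonal one has no X-term, and its cofactor cannot make up for the missing degree.
  minor-monic : ∀ {C : Set} (A : C → C → Poly) → (∀ i c → DegLt 2 (A i c)) →
    (∀ i → coeff (A i i) 1 ≡ 1#) → (∀ i c → i ≢ c → coeff (A i c) 1 ≡ 0#) →
    ∀ {is} → Unique is → Monic (length is) (minor (List.map A is) is)
  minor-monic A deg diag off {is} u = top u , small is is
    where
    open ≡-Reasoning
    small : ∀ is cs → DegLt (suc (length is)) (minor (List.map A is) cs)
    small is cs = subst (λ n → DegLt (suc n) (minor (List.map A is) cs)) (Listₚ.length-map A is)
      (DegLt-minor (List.map A is) (Allₚ.map⁺ (All.universal deg is)) cs)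
    top : ∀ {is} → Unique is → coeff (minor (List.map A is) is) (length is) ≡ 1#
    top [] = refl
    top {i ∷ is} (i∉is ∷ u) = begin
      coeff (contract (A i) (minor (List.map A is)) (i ∷ is)) (suc (length is))
        ≡⟨ coeff-+ (A i i *ₚ minor (List.map A is) is) _ (suc (length is)) ⟩
      coeff (A i i *ₚ minor (List.map A is) is) (suc (length is)) +
        coeff (-ₚ contract (A i) (λ ds → minor (List.map A is) (i ∷ ds)) is) (suc (length is))
        ≡⟨ cong₂ _+_
            (trans (coeff-*-top 1 (length is) (A i i) _ (deg i i) (small is is)) (cong₂ _*_ (diag i) (top u)))
            (trans (coeff-neg (contract (A i) (λ ds → minor (List.map A is) (i ∷ ds)) is) (suc (length is)))
              (cong -_ (coeff-contract-0 (A i) (λ ds → minor (List.map A is) (i ∷ ds)) (deg i)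
                (λ ds → small is (i ∷ ds)) (All.map (λ {c} → off i c) i∉is)))) ⟩
      1# * 1# + - 0#
        ≡⟨ solve 0 (con 1ℤ :* con 1ℤ :+ (:- con 0ℤ) := con 1ℤ) refl ⟩
      1# ∎

  -- The determinant trick and the Cayley-Hamilton theorem.

  vsum : ∀ {k} {I : Set} → (I → Vec F k) → List I → Vec F k
  vsum f []       = 𝟎
  vsum f (i ∷ is) = f i ⊞ vsum f is

  vsum-single : ∀ {k} {I : Set} (f : I → Vec F k) is i js →
    (∀ {j} → j ∈ is ++ js → f j ≡ 𝟎) → vsum f (is ++ i ∷ js) ≡ f i
  vsum-single f [] i js z = trans (cong (f i ⊞_) (vanish js z)) (⊞-identityʳ _)
    where
    vanish : ∀ js → (∀ {j} → j ∈ js → f j ≡ 𝟎) → vsum f js ≡ 𝟎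
    vanish []       z = refl
    vanish (j ∷ js) z = trans (cong₂ _⊞_ (z (here refl)) (vanish js (z ∘ there))) (⊞-identityˡ 𝟎)
  vsum-single f (j ∷ is) i js z = trans
    (cong₂ _⊞_ (z (here refl)) (vsum-single f is i js (z ∘ there))) (⊞-identityˡ _)

  lookup-vsum : ∀ {k n} (f : Fin n → Vec F k) l →
    lookup (vsum f (List.allFin n)) l ≡ sumF (λ i → lookup (f i) l)
  lookup-vsum {n = n} f l = go id
    where
    go : ∀ {n′} (g : Fin n′ → Fin n) →
      lookup (vsum f (List.tabulate g)) l ≡ sumF (λ i → lookup (f (g i)) l)
    go {zero}  g = lookup-𝟎 l
    go {suc _} g = trans (lookup-⊞ (f (g zero)) _ l) (cong (lookup (f (g zero)) l +_) (go (g ∘ suc)))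

  module _ {k : ℕ} (T : Vec F k → Vec F k) (T-linear : Linear T) where
    open Action T T-linear

    module _ {C I : Set} (A : I → C → Poly) (e : I → Vec F k) (is : List I) where

      -- Σᵢ (contract Aᵢ D) eᵢ is the contraction of D by the vector-valued functional Σᵢ Aᵢ eᵢ.
      contract-vsum-0 : (∀ c → vsum (λ i → act (A i c) (e i)) is ≡ 𝟎) →
        ∀ D cs → vsum (λ i → act (contract (A i) D cs) (e i)) is ≡ 𝟎
      contract-vsum-0 rel D [] = vsum-[] is
        where
        vsum-[] : ∀ is → vsum (λ i → act [] (e i)) is ≡ 𝟎
        vsum-[] []       = refl
        vsum-[] (i ∷ is) = trans (⊞-identityˡ _) (vsum-[] is)
      contract-vsum-0 rel D (c ∷ cs) = trans (split is) (trans
        (cong₂ (λ v w → act (D cs) v ⊞ (⊟ w)) (rel c) (contract-vsum-0 rel (λ ds → D (c ∷ ds)) cs))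
        (trans (cong₂ _⊞_ (0-hom (act-linear (D cs))) ⊟-𝟎) (⊞-identityˡ 𝟎)))
        where
        E = λ i → contract (A i) (λ ds → D (c ∷ ds)) cs
        split : ∀ is → vsum (λ i → act (contract (A i) D (c ∷ cs)) (e i)) is ≡
          act (D cs) (vsum (λ i → act (A i c) (e i)) is) ⊞ (⊟ vsum (λ i → act (E i) (e i)) is)
        split [] = sym (trans (cong₂ _⊞_ (0-hom (act-linear (D cs))) ⊟-𝟎) (⊞-identityˡ 𝟎))
        split (i ∷ is) = begin
          act ((A i c *ₚ D cs) +ₚ (-ₚ E i)) (e i) ⊞ vsum (λ i → act (contract (A i) D (c ∷ cs)) (e i)) is
            ≡⟨ cong₂ _⊞_ (trans (act-+ (A i c *ₚ D cs) _ (e i))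
                 (cong₂ _⊞_ (trans (act-* (A i c) (D cs) (e i)) (act-comm (A i c) (D cs) (e i))) (act-neg (E i) (e i))))
                 (split is) ⟩
          (act (D cs) (act (A i c) (e i)) ⊞ (⊟ act (E i) (e i))) ⊞
            (act (D cs) (vsum (λ i → act (A i c) (e i)) is) ⊞ (⊟ vsum (λ i → act (E i) (e i)) is))
            ≡⟨ ⊞-interchange _ _ _ _ ⟩
          (act (D cs) (act (A i c) (e i)) ⊞ act (D cs) (vsum (λ i → act (A i c) (e i)) is)) ⊞
            ((⊟ act (E i) (e i)) ⊞ (⊟ vsum (λ i → act (E i) (e i)) is))
            ≡⟨ cong₂ _⊞_ (+-hom (act-linear (D cs)) _ _) (⊟-⊞ _ _) ⟨
          act (D cs) (act (A i c) (e i) ⊞ vsum (λ i → act (A i c) (e i)) is) ⊞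
            (⊟ (act (E i) (e i) ⊞ vsum (λ i → act (E i) (e i)) is)) ∎
          where open ≡-Reasoning

      -- The determinant trick, with one row replaced in place of an adjugate. After row l is moved
      -- to the front, the determinant applied to e l is one term of the sum over i of the
      -- determinants with `A i` as first row, applied to e i. The other terms have a repeated row,
      -- and the whole sum vanishes by the relations.
      minor-annihilates : (∀ c → vsum (λ i → act (A i c) (e i)) is ≡ 𝟎) →
        ∀ {l} → l ∈ is → ∀ cs → act (minor (List.map A is) cs) (e l) ≡ 𝟎
      minor-annihilates rel {l} l∈is cs with ∈-∃++ l∈is
      ... | js , ks , refl with row-to-front (List.map A js) (A l) (List.map A ks)
      ... | ε , eq = begin
        act (minor (List.map A (js ++ l ∷ ks)) cs) (e l)
          ≡⟨ cong (λ rs → act (minor rs cs) (e l)) (Listₚ.map-++ A js (l ∷ ks)) ⟩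
        act (minor (List.map A js ++ A l ∷ List.map A ks) cs) (e l)
          ≡⟨ act-cong (eq cs) (e l) ⟩
        act (ε *ₚ contract (A l) D cs) (e l)
          ≡⟨ act-* ε _ (e l) ⟩
        act ε (act (contract (A l) D cs) (e l))
          -- For j different from l the row `A j` is still among the rows of D, so adding its term
          -- changes nothing.
          ≡⟨ cong (act ε) (sym (vsum-single (λ i → act (contract (A i) D cs) (e i)) js l ks
               (λ {j} j∈ → act-≋[] {contract (A j) D cs} (repeated-row
                  (subst (A j ∈_) (Listₚ.map-++ A js ks) (∈-map⁺ A j∈)) cs) (e j)))) ⟩
        act ε (vsum (λ i → act (contract (A i) D cs) (e i)) (js ++ l ∷ ks))
          ≡⟨ cong (act ε) (contract-vsum-0 rel D cs) ⟩
        act ε 𝟎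
          ≡⟨ 0-hom (act-linear ε) ⟩
        𝟎 ∎
        where
        open ≡-Reasoning
        D = minor (List.map A js ++ List.map A ks)

  module _ {k : ℕ} (S : Matrix F k) where

    charEntry : Fin k → Fin k → Poly
    charEntry i j = (Xₚ *ₚ const (δ i j)) +ₚ (-ₚ const (entry S i j))

    charEntry-≋ : ∀ i j → charEntry i j ≋ ((- entry S i j) ∷ δ i j ∷ [])
    charEntry-≋ i j = ext λ where
      zero          → solve 2 (λ d s → con 0ℤ :* d :+ con 0ℤ :+ (:- s) := :- s) refl (δ i j) (entry S i j)
      (suc zero)    → solve 1 (λ d → con 1ℤ :* d :+ con 0ℤ := d) refl (δ i j)
      (suc (suc n)) → refl

    charPoly-minor : charPoly S ≡
      minor (List.map charEntry (List.allFin k)) (List.allFin k)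
    charPoly-minor = begin
      detₚ (tabulate λ i → tabulate (charEntry i))
        ≡⟨ cong detₚ (trans (Vecₚ.tabulate-cong λ i → Vecₚ.tabulate-allFin (charEntry i)) (Vecₚ.tabulate-allFin _)) ⟩
      detₚ (Vec.map (λ i → Vec.map (charEntry i) (Vec.allFin k)) (Vec.allFin k))
        ≡⟨ detₚ-minor charEntry (Vec.allFin k) (Vec.allFin k) ⟩
      minor (List.map charEntry (toList (Vec.allFin k))) (toList (Vec.allFin k))
        ≡⟨ cong (λ is → minor (List.map charEntry is) is) (toList-tabulate id) ⟩
      minor (List.map charEntry (List.allFin k)) (List.allFin k) ∎
      where
      open ≡-Reasoning
      toList-tabulate : ∀ {A : Set} {n} (f : Fin n → A) → toList (tabulate f) ≡ List.tabulate f
      toList-tabulate {n = zero}  f = refl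
      toList-tabulate {n = suc n} f = cong (f zero ∷_) (toList-tabulate (f ∘ suc))

    charPoly-monic : Monic k (charPoly S)
    charPoly-monic = subst (Monic k) (sym charPoly-minor) (subst (λ n → Monic n (minor (List.map charEntry (List.allFin k)) (List.allFin k))) (Listₚ.length-tabulate id)
      (minor-monic charEntry
        (λ { i c (suc (suc n)) (s≤s (s≤s _)) → refl })
        (λ i → trans (at (charEntry-≋ i i) 1) (δ-refl i))
        (λ i c i≢c → trans (at (charEntry-≋ i c) 1) (δ-≢ i≢c))
        (Uniqueₚ.allFin⁺ k)))

    open Action (S ∙_) (∙-linear S)

    -- Since X acts as S, column c of S says that X e_c is the combination of the unit vectors with
    -- coefficients `entry S i c`; with everything on one side these are the relations for the
    -- determinant trick.
    charEntry-relation : ∀ c → vsum (λ i → act (charEntry i c) (unit i)) (List.allFin k) ≡ 𝟎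
    charEntry-relation c = lookup-ext λ l → begin
      lookup (vsum (λ i → act (charEntry i c) (unit i)) (List.allFin k)) l
        ≡⟨ lookup-vsum (λ i → act (charEntry i c) (unit i)) l ⟩
      sumF (λ i → lookup (act (charEntry i c) (unit i)) l)
        ≡⟨ sum-cong (λ i → trans (cong (λ v → lookup v l) (linear-action i)) (coordinates i l)) ⟩
      sumF (λ i → (- 1#) * (entry S i c * δ l i) + entry S l i * δ i c)
        ≡⟨ sum-+ (λ i → (- 1#) * (entry S i c * δ l i)) (λ i → entry S l i * δ i c) ⟩
      sumF (λ i → (- 1#) * (entry S i c * δ l i)) + sumF (λ i → entry S l i * δ i c)
        ≡⟨ cong₂ _+_ (trans (sum-* (- 1#) (λ i → entry S i c * δ l i))
             (cong ((- 1#) *_) (trans (sum-cong (λ i → 𝔽ᵣ.*-comm (entry S i c) (δ l i))) (sum-δˡ (λ i → entry S i c) l))))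
             (sum-δʳ (entry S l) c) ⟩
      (- 1#) * entry S l c + entry S l c
        ≡⟨ solve 1 (λ s → (:- con 1ℤ) :* s :+ s := con 0ℤ) refl (entry S l c) ⟩
      0#
        ≡⟨ lookup-𝟎 l ⟨
      lookup 𝟎 l ∎
      where
      open ≡-Reasoning
      linear-action : ∀ i → act (charEntry i c) (unit i) ≡ (- entry S i c) • unit i ⊞ δ i c • S ∙ unit i
      linear-action i = trans (act-cong (charEntry-≋ i c) (unit i)) (cong ((- entry S i c) • unit i ⊞_)
        (trans (cong (S ∙_) (trans (cong (δ i c • unit i ⊞_) (0-hom (∙-linear S))) (⊞-identityʳ _)))
          (•-hom (∙-linear S) (δ i c) (unit i))))
      coordinates : ∀ i l → lookup ((- entry S i c) • unit i ⊞ δ i c • S ∙ unit i) l ≡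
        (- 1#) * (entry S i c * δ l i) + entry S l i * δ i c
      coordinates i l = begin
        lookup ((- entry S i c) • unit i ⊞ δ i c • S ∙ unit i) l
          ≡⟨ lookup-⊞ ((- entry S i c) • unit i) _ l ⟩
        lookup ((- entry S i c) • unit i) l + lookup (δ i c • S ∙ unit i) l
          ≡⟨ cong₂ _+_ (trans (lookup-• (- entry S i c) (unit i) l) (cong ((- entry S i c) *_) (lookup-unit l i)))
               (trans (lookup-• (δ i c) (S ∙ unit i) l) (cong (δ i c *_) (lookup-∙-unit S l i))) ⟩
        (- entry S i c) * δ l i + δ i c * entry S l i
          ≡⟨ solve 4 (λ s d e t → (:- s) :* d :+ e :* t := (:- con 1ℤ) :* (s :* d) :+ t :* e) refl
               (entry S i c) (δ l i) (δ i c) (entry S l i) ⟩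
        (- 1#) * (entry S i c * δ l i) + entry S l i * δ i c ∎

    cayley-hamilton : ∀ v → act (charPoly S) v ≡ 𝟎
    cayley-hamilton = linear-ext (act-linear (charPoly S))
      (record { +-hom = λ _ _ → sym (⊞-identityˡ 𝟎) ; •-hom = λ a _ → sym (•-𝟎 a) })
      λ j → trans (cong (λ p → act p (unit j)) charPoly-minor)
        (minor-annihilates (S ∙_) (∙-linear S) charEntry unit (List.allFin k) charEntry-relation (∈-allFin j) (List.allFin k))

open import Data.Nat using (_^_)

-- Enumeration of F^k and of its nonzero vectors.

module FiniteVectors (𝔽 : FiniteField) where
  open FiniteField 𝔽 using (elements; elements-complete; elements-unique; size)
  open FF 𝔽
  open LinearAlgebra 𝔽

  vectors : ∀ k → List (Vec F k)
  vectors zero    = [] ∷ []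
  vectors (suc k) = List.cartesianProductWith _∷_ elements (vectors k)

  vectors-complete : ∀ {k} (v : Vec F k) → v ∈ vectors k
  vectors-complete []      = here refl
  vectors-complete (x ∷ v) = ∈-cartesianProductWith⁺ _∷_ (elements-complete x) (vectors-complete v)

  vectors-unique : ∀ k → Unique (vectors k)
  vectors-unique zero    = [] ∷ []
  vectors-unique (suc k) =
    Uniqueₚ.cartesianProductWith⁺ _∷_ Vecₚ.∷-injective elements-unique (vectors-unique k)

  length-vectors : ∀ k → length (vectors k) ≡ size ^ k
  length-vectors zero    = refl
  length-vectors (suc k) = trans (length-cartesianProductWith _∷_ elements (vectors k))
    (cong (size ℕ.*_) (length-vectors k))

  nonzero? : ∀ {k} (v : Vec F k) → Dec (v ≢ 𝟎)
  nonzero? v = ¬? (v ≟ᵥ 𝟎)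

  nonzeroVectors : ∀ k → List (Vec F k)
  nonzeroVectors k = List.filter nonzero? (vectors k)

  nonzero-∈ : ∀ {k} {v : Vec F k} → v ≢ 𝟎 → v ∈ nonzeroVectors k
  nonzero-∈ {v = v} v≢𝟎 = ∈-filter⁺ nonzero? (vectors-complete v) v≢𝟎

  ∈-nonzero : ∀ {k} {v : Vec F k} → v ∈ nonzeroVectors k → v ≢ 𝟎
  ∈-nonzero {k} v∈ = proj₂ (∈-filter⁻ nonzero? {xs = vectors k} v∈)

  nonzeroVectors-unique : ∀ k → Unique (nonzeroVectors k)
  nonzeroVectors-unique k = Uniqueₚ.filter⁺ nonzero? (vectors-unique k)

  length-nonzeroVectors : ∀ k → length (nonzeroVectors k) ≡ size ^ k ∸ 1
  length-nonzeroVectors k = cong (_∸ 1) (trans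
    (ℕₚ.≤-antisym
      (length-≤-by-relation _≡_ {𝟎 ∷ nonzeroVectors k} {vectors k}
        (Allₚ.¬Any⇒All¬ _ (λ p → ∈-nonzero p refl) ∷ nonzeroVectors-unique k)
        (λ {v} _ → v , vectors-complete v , refl) (λ p q → trans p (sym q)))
      (length-≤-by-relation _≡_ {vectors k} {𝟎 ∷ nonzeroVectors k} (vectors-unique k)
        (λ {v} _ → v , covered v , refl) (λ p q → trans p (sym q))))
    (length-vectors k))
    where
    covered : ∀ v → v ∈ 𝟎 ∷ nonzeroVectors k
    covered v with v ≟ᵥ 𝟎
    ... | yes v≡𝟎 = here v≡𝟎
    ... | no  v≢𝟎 = there (nonzero-∈ v≢𝟎)

-- V as a one-dimensional vector space over K = F[X]/(f).

module Cyclic (𝔽 : FiniteField) {k : ℕ}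
  (f : FF.Poly 𝔽) (monic : Polynomials.Monic 𝔽 k f) (irreducible : FF.Irreducible 𝔽 f)
  (T : Vec (FF.F 𝔽) k → Vec (FF.F 𝔽) k) (T-linear : LinearAlgebra.Linear 𝔽 T)
  (f-annihilates : ∀ v → LinearAlgebra.Action.act 𝔽 T T-linear f v ≡ LinearAlgebra.𝟎 𝔽)
  where

  open FF 𝔽
  open Polynomials 𝔽
  open LinearAlgebra 𝔽
  open FiniteField 𝔽 using (0#; 1#; 0≢1; inverse)
  open 𝔽ᵣ using (_+_; _*_; -_)
  open Action T T-linear public
  open FiniteVectors 𝔽
  open ≡-Reasoning

  act-*-zeroʳ : ∀ p q {v} → act q v ≡ 𝟎 → act (p *ₚ q) v ≡ 𝟎
  act-*-zeroʳ p q {v} e = trans (act-* p q v) (trans (cong (act p) e) (0-hom (act-linear p)))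

  act-*-zeroˡ : ∀ p q {v} → act p v ≡ 𝟎 → act (p *ₚ q) v ≡ 𝟎
  act-*-zeroˡ p q {v} e = trans (act-cong (*ₚ-comm p q) v) (act-*-zeroʳ q p e)

  act-remainder : ∀ p q s r {v} → p ≋ ((q *ₚ s) +ₚ r) → act q v ≡ 𝟎 → act r v ≡ act p v
  act-remainder p q s r {v} eq e = sym (begin
    act p v                       ≡⟨ act-cong eq v ⟩
    act ((q *ₚ s) +ₚ r) v         ≡⟨ act-+ (q *ₚ s) r v ⟩
    act (q *ₚ s) v ⊞ act r v      ≡⟨ cong (_⊞ act r v) (act-*-zeroˡ q s e) ⟩
    𝟎 ⊞ act r v                   ≡⟨ ⊞-identityˡ _ ⟩
    act r v                       ∎)

  normalise : ∀ {e} p → coeff p e ≢ 0# → DegLt (suc e) p → ∃ λ b → Monic e (scale b p)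
  normalise {e} p lead deg with inverse _ lead
  ... | b , eq = b , trans (coeff-scale b p e) (trans (𝔽ᵣ.*-comm b _) eq) , DegLt-scale b p deg

  ≋⇒+-≋ : ∀ p {q r} → r ≋ [] → p ≋ (q +ₚ r) → p ≋ q
  ≋⇒+-≋ p {q} r≋[] e = ≋-trans e (≋-trans (+ₚ-cong {q} ≋-refl r≋[]) (+ₚ-identityʳ q))

  -- A monic annihilator of least degree divides f, hence is a unit or an associate of f.
  monic-annihilator : ∀ n {d} → d < n → d < k → ∀ p → Monic d p →
    ∀ {w} → w ≢ 𝟎 → act p w ≢ 𝟎
  monic-annihilator (suc n) {d} (s≤s d≤n) d<k p p-monic {w} w≢𝟎 pw≡𝟎 with divide p p-monic f
  ... | s , r , f≋ , r-small with leading d r r-small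
  -- A nonzero remainder of f modulo p also annihilates w. Made monic, it contradicts the induction
  -- hypothesis in smaller degree; n only bounds the number of descents.
  ... | inj₂ (e , e<d , lead , deg) with normalise r lead deg
  ... | b , r-monic = monic-annihilator n (ℕₚ.<-≤-trans e<d d≤n) (ℕₚ.<-trans e<d d<k)
          (scale b r) r-monic w≢𝟎 (begin
            act (scale b r) w  ≡⟨ act-scale b r w ⟩
            b • act r w        ≡⟨ cong (b •_) (trans (act-remainder f p s r f≋ pw≡𝟎) (f-annihilates w)) ⟩
            b • 𝟎              ≡⟨ •-𝟎 b ⟩
            𝟎                  ∎)
  monic-annihilator (suc n) {d} (s≤s d≤n) d<k p p-monic {w} w≢𝟎 pw≡𝟎
      | s , r , f≋ , r-small | inj₁ r≋[] = [ unit-p , unit-s ]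
        (proj₂ (proj₂ irreducible) p s (at f≋ps))
    where
    f≋ps : f ≋ (p *ₚ s)
    f≋ps = ≋⇒+-≋ f r≋[] f≋
    unit-p : IsUnitₚ p → ⊥
    unit-p (h , ph≈1) = w≢𝟎 (begin
      w               ≡⟨ act-1 w ⟨
      act 1ₚ w        ≡⟨ act-cong {p *ₚ h} {1ₚ} (ext ph≈1) w ⟨
      act (p *ₚ h) w  ≡⟨ act-*-zeroˡ p h pw≡𝟎 ⟩
      𝟎               ∎)
    -- With h inverse to s one gets p = f h. The leading coefficient of h then appears in p in
    -- degree k + e, beyond d < k.
    unit-s : IsUnitₚ s → ⊥
    unit-s (h , sh≈1) with leading (length h) h (coeff-beyond h)
      where
      coeff-beyond : ∀ p → DegLt (length p) p
      coeff-beyond []      i       _         = refl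
      coeff-beyond (a ∷ p) (suc i) (s≤s l≤i) = coeff-beyond p i l≤i
    ... | inj₁ h≋[] = 0≢1 (trans (sym (at (≋-trans (*ₚ-congˡ s h≋[]) (*ₚ-zeroʳ s)) 0)) (sh≈1 0))
    ... | inj₂ (e , _ , lead , deg) = lead (begin
      coeff h e                  ≡⟨ 𝔽ᵣ.*-identityˡ _ ⟨
      1# * coeff h e             ≡⟨ cong (_* coeff h e) (proj₁ monic) ⟨
      coeff f k * coeff h e      ≡⟨ coeff-*-top k e f h (proj₂ monic) deg ⟨
      coeff (f *ₚ h) (k ℕ.+ e)   ≡⟨ at fh≋p (k ℕ.+ e) ⟩
      coeff p (k ℕ.+ e)          ≡⟨ proj₂ p-monic (k ℕ.+ e) (ℕₚ.≤-trans d<k (ℕₚ.m≤m+n k e)) ⟩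
      0#                         ∎)
      where
      fh≋p : (f *ₚ h) ≋ p
      fh≋p = ≋-trans (*ₚ-cong {q = h} f≋ps ≋-refl) (≋-trans (*ₚ-assoc p s h)
        (≋-trans (*ₚ-congˡ p (ext sh≈1)) (≋-trans (*ₚ-comm p 1ₚ) (*ₚ-identityˡ p))))

  small-annihilator : ∀ {p} → DegLt k p → ∀ {w} → w ≢ 𝟎 → act p w ≡ 𝟎 → p ≋ []
  small-annihilator {p} deg {w} w≢𝟎 pw≡𝟎 with leading k p deg
  ... | inj₁ p≋[] = p≋[]
  ... | inj₂ (e , e<k , lead , deg′) with normalise p lead deg′
  ... | b , p-monic = ⊥-elim (monic-annihilator (suc e) ℕₚ.≤-refl e<k (scale b p) p-monic w≢𝟎
          (trans (act-scale b p w) (trans (cong (b •_) pw≡𝟎) (•-𝟎 b))))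

  abstract
    annihilator-multiple : ∀ p {w} → w ≢ 𝟎 → act p w ≡ 𝟎 → ∃ λ s → p ≋ (f *ₚ s)
    annihilator-multiple p {w} w≢𝟎 pw≡𝟎 with divide f monic p
    ... | s , r , eq , small = s , ≋⇒+-≋ p
      (small-annihilator {r} small w≢𝟎 (trans (act-remainder p f s r eq (f-annihilates w)) pw≡𝟎)) eq

  act-multiple : ∀ {p s} → p ≋ (f *ₚ s) → ∀ v → act p v ≡ 𝟎
  act-multiple {p} {s} eq v = trans (act-cong eq v) (act-*-zeroˡ f s (f-annihilates v))

  act-sub : ∀ p q v → act p v ≡ act q v → act (p +ₚ (-ₚ q)) v ≡ 𝟎
  act-sub p q v eq = trans (act-+ p (-ₚ q) v)
    (trans (cong₂ _⊞_ eq (act-neg q v)) (⊞-inverseʳ (act q v)))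

  sub≋[]⇒≋ : ∀ p q → (p +ₚ (-ₚ q)) ≋ [] → p ≋ q
  sub≋[]⇒≋ p q e = ≋-trans
    (Pₛ.solve 2 (λ p q → p Pₛ.:= (p Pₛ.:- q) Pₛ.:+ q) ≋-refl p q) (+ₚ-cong {q = q} e ≋-refl)
    where module Pₛ = IntegerSolver polyRing

  coeff-toList-injective : ∀ {l} {v w : Vec F l} → toList v ≋ toList w → v ≡ w
  coeff-toList-injective {v = []}    {[]}    e = refl
  coeff-toList-injective {v = x ∷ v} {y ∷ w} e =
    cong₂ _∷_ (at e 0) (coeff-toList-injective (ext λ i → at e (suc i)))

  DegLt-toList : ∀ {l} (v : Vec F l) → DegLt l (toList v)
  DegLt-toList []      i       _         = refl
  DegLt-toList (x ∷ v) (suc i) (s≤s l≤i) = DegLt-toList v i l≤i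

  abstract
    -- Polynomials of degree below k are given by k coefficients, so they are as many as the vectors
    -- of V; evaluation at w is injective on them because no nonzero one annihilates w, hence it is
    -- onto.
    cyclic : ∀ {w} → w ≢ 𝟎 → ∀ v → ∃ λ p → act p w ≡ v
    cyclic {w} w≢𝟎 v with injective⇒surjective _≟ᵥ_ (vectors k) (vectors-unique k) vectors-complete
      (λ x → act (toList x) w)
      (λ {x} {y} eq → coeff-toList-injective (sub≋[]⇒≋ (toList x) (toList y)
        (small-annihilator (DegLt-+ (toList x) _ (DegLt-toList x) (DegLt-neg (toList y) (DegLt-toList y)))
          w≢𝟎 (act-sub (toList x) (toList y) w eq))))
      v
    ... | x , eq = toList x , eq

  -- The leading terms cancel in g - f, which leaves an annihilator of degree below k. This
  -- identifies the characteristic polynomial of a conjugate of T.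
  annihilator-unique : ∀ {w} → w ≢ 𝟎 → ∀ {g} → Monic k g → act g w ≡ 𝟎 → g ≋ f
  annihilator-unique {w} w≢𝟎 {g} g-monic gw≡𝟎 = sub≋[]⇒≋ g f (small-annihilator small w≢𝟎
    (act-sub g f w (trans gw≡𝟎 (sym (f-annihilates w)))))
    where
    small : DegLt k (g +ₚ (-ₚ f))
    small i k≤i with ℕₚ.m≤n⇒m<n∨m≡n k≤i
    ... | inj₁ k<i = DegLt-+ g (-ₚ f) (proj₂ g-monic) (DegLt-neg f (proj₂ monic)) i k<i
    ... | inj₂ refl = trans (coeff-+ g (-ₚ f) k)
      (trans (cong₂ _+_ (proj₁ g-monic) (trans (coeff-neg f k) (cong -_ (proj₁ monic)))) (𝔽ᵣ.-‿inverseʳ 1#))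

  -- Every nonzero vector has the annihilator (f), and f kills all of V. A congruence modulo f can
  -- therefore be tested on any one nonzero vector.
  act-integral : ∀ p {v} → v ≢ 𝟎 → act p v ≡ 𝟎 → ∀ w → act p w ≡ 𝟎
  act-integral p v≢𝟎 e with annihilator-multiple p v≢𝟎 e
  ... | s , p≋ = act-multiple p≋

  -- F[X]/(f), with congruence modulo f tested on w.
  quotientRing : Vec F k → CommutativeRing 0ℓ 0ℓ
  quotientRing w = record
    { Carrier = Poly ; _≈_ = λ p q → act p w ≡ act q w
    ; _+_ = _+ₚ_ ; _*_ = _*ₚ_ ; -_ = -ₚ_ ; 0# = 0ₚ ; 1# = 1ₚ
    ; isCommutativeRing = record
      { isRing = record
        { +-isAbelianGroup = record
          { isGroup = record
            { isMonoid = record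
              { isSemigroup = record
                { isMagma = record
                  { isEquivalence = record { refl = refl ; sym = sym ; trans = trans }
                  ; ∙-cong = λ {p} {p′} {q} {q′} e e′ →
                      trans (act-+ p q w) (trans (cong₂ _⊞_ e e′) (sym (act-+ p′ q′ w))) }
                ; assoc = λ p q r → act-cong (Pᵣ.+-assoc p q r) w }
              ; identity = (λ p → act-cong (Pᵣ.+-identityˡ p) w) , (λ p → act-cong (Pᵣ.+-identityʳ p) w) }
            ; inverse = (λ p → act-cong (Pᵣ.-‿inverseˡ p) w) , (λ p → act-cong (Pᵣ.-‿inverseʳ p) w)
            ; ⁻¹-cong = λ {p} {q} e → trans (act-neg p w) (trans (cong ⊟_ e) (sym (act-neg q w))) }
          ; comm = λ p q → act-cong (Pᵣ.+-comm p q) w }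
        ; *-cong = λ {p} {p′} {q} {q′} e e′ → begin
            act (p *ₚ q) w      ≡⟨ act-* p q w ⟩
            act p (act q w)     ≡⟨ cong (act p) e′ ⟩
            act p (act q′ w)    ≡⟨ act-comm p q′ w ⟩
            act q′ (act p w)    ≡⟨ cong (act q′) e ⟩
            act q′ (act p′ w)   ≡⟨ act-comm q′ p′ w ⟩
            act p′ (act q′ w)   ≡⟨ act-* p′ q′ w ⟨
            act (p′ *ₚ q′) w    ∎
        ; *-assoc = λ p q r → act-cong (Pᵣ.*-assoc p q r) w
        ; *-identity = (λ p → act-cong (Pᵣ.*-identityˡ p) w) , (λ p → act-cong (Pᵣ.*-identityʳ p) w)
        ; distrib = (λ p q r → act-cong (Pᵣ.distribˡ p q r) w) , (λ p q r → act-cong (Pᵣ.distribʳ p q r) w) }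
      ; *-comm = λ p q → act-cong (Pᵣ.*-comm p q) w } }
    where module Pᵣ = CommutativeRing polyRing

  quotientRing-integral : ∀ {w} → ∀ {p q} →
    act (p *ₚ q) w ≡ 𝟎 → act p w ≢ 𝟎 → act q w ≡ 𝟎
  quotientRing-integral {w} {p} {q} e pw≢𝟎 = act-integral q pw≢𝟎
    (trans (act-comm q p w) (trans (sym (act-* p q w)) e)) w

-- Block decomposition and TSR matrices as shift operators.

module BlockSums (𝔽 : FiniteField) where
  open FF 𝔽
  open Polynomials 𝔽
  open 𝔽ᵣ using (_+_)

  sum-++ : ∀ m {k} (g : Fin (m ℕ.+ k) → F) →
    sumF g ≡ sumF (λ b → g (b ↑ˡ k)) + sumF (λ l → g (m ↑ʳ l))
  sum-++ zero    g = sym (𝔽ᵣ.+-identityˡ _)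
  sum-++ (suc m) g = trans (cong (g zero +_) (sum-++ m (g ∘ suc))) (sym (𝔽ᵣ.+-assoc _ _ _))

  sum-combine : ∀ n {m} (g : Fin (n ℕ.* m) → F) →
    sumF g ≡ sumF (λ (j : Fin n) → sumF (λ (b : Fin m) → g (combine j b)))
  sum-combine zero        g = refl
  sum-combine (suc n) {m} g = trans (sum-++ m g)
    (cong (sumF (λ b → g (b ↑ˡ (n ℕ.* m))) +_) (sum-combine n (λ l → g (m ↑ʳ l))))

  sum-last : ∀ {n} (h : Fin (suc n) → F) → sumF h ≡ sumF (h ∘ inject₁) + h (fromℕ n)
  sum-last {zero}  h = 𝔽ᵣ.+-comm _ _
  sum-last {suc n} h = trans (cong (h zero +_) (sum-last (h ∘ suc))) (sym (𝔽ᵣ.+-assoc _ _ _))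

module Blocks (𝔽 : FiniteField) (n m : ℕ) where
  open FF 𝔽
  open Polynomials 𝔽
  open LinearAlgebra 𝔽
  open FiniteField 𝔽 using (0#)
  open 𝔽ᵣ using (_+_; _*_)
  open ≡-Reasoning
  open BlockSums 𝔽

  abstract
    block : Fin (suc n) → Vec F (suc n ℕ.* m) → Vec F m
    block i v = tabulate λ a → lookup v (combine i a)

    fromBlocks : (Fin (suc n) → Vec F m) → Vec F (suc n ℕ.* m)
    fromBlocks g = tabulate λ l → lookup (g (proj₁ (remQuot {suc n} m l))) (proj₂ (remQuot {suc n} m l))

    lookup-block : ∀ i v a → lookup (block i v) a ≡ lookup v (combine i a)
    lookup-block i v a = Vecₚ.lookup∘tabulate _ a

    block-fromBlocks : ∀ g i → block i (fromBlocks g) ≡ g i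
    block-fromBlocks g i = lookup-ext λ a → trans (lookup-block i (fromBlocks g) a)
      (trans (Vecₚ.lookup∘tabulate _ (combine i a))
        (cong (λ (i′ , a′) → lookup (g i′) a′) (Finₚ.remQuot-combine {suc n} {m} i a)))

  block-ext : ∀ {v w} → (∀ i → block i v ≡ block i w) → v ≡ w
  block-ext {v} {w} eq = lookup-ext λ l → helper l (Finₚ.combine-surjective {suc n} {m} l)
    where
    helper : ∀ l → ∃₂ (λ i a → combine i a ≡ l) → lookup v l ≡ lookup w l
    helper l (i , a , refl) = trans (sym (lookup-block i v a))
      (trans (cong (λ x → lookup x a) (eq i)) (lookup-block i w a))

  block-linear : ∀ i → Linear (block i)
  block-linear i = record
    { +-hom = λ v w → lookup-ext λ a → trans (lookup-block i (v ⊞ w) a)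
        (trans (lookup-⊞ v w (combine i a)) (trans
          (cong₂ _+_ (sym (lookup-block i v a)) (sym (lookup-block i w a)))
          (sym (lookup-⊞ (block i v) (block i w) a))))
    ; •-hom = λ x v → lookup-ext λ a → trans (lookup-block i (x • v) a)
        (trans (lookup-• x v (combine i a)) (trans
          (cong (x *_) (sym (lookup-block i v a)))
          (sym (lookup-• x (block i v) a)))) }

  -- the block-diagonal operator I ⊗ P
  lift : Matrix F m → Vec F (suc n ℕ.* m) → Vec F (suc n ℕ.* m)
  lift P v = fromBlocks (λ i → P ∙ block i v)

  block-lift : ∀ P i v → block i (lift P v) ≡ P ∙ block i v
  block-lift P i v = block-fromBlocks (λ i → P ∙ block i v) i

  lift-linear : ∀ P → Linear (lift P)
  lift-linear P = record
    { +-hom = λ v w → block-ext λ i → begin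
        block i (lift P (v ⊞ w))                 ≡⟨ block-lift P i (v ⊞ w) ⟩
        P ∙ block i (v ⊞ w)                      ≡⟨ +-hom (Linear-∘ (∙-linear P) (block-linear i)) v w ⟩
        P ∙ block i v ⊞ P ∙ block i w            ≡⟨ cong₂ _⊞_ (block-lift P i v) (block-lift P i w) ⟨
        block i (lift P v) ⊞ block i (lift P w)  ≡⟨ +-hom (block-linear i) _ _ ⟨
        block i (lift P v ⊞ lift P w)            ∎
    ; •-hom = λ a v → block-ext λ i → begin
        block i (lift P (a • v))    ≡⟨ block-lift P i (a • v) ⟩
        P ∙ block i (a • v)         ≡⟨ •-hom (Linear-∘ (∙-linear P) (block-linear i)) a v ⟩
        a • P ∙ block i v           ≡⟨ cong (a •_) (block-lift P i v) ⟨
        a • block i (lift P v)      ≡⟨ •-hom (block-linear i) a _ ⟨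
        block i (a • lift P v)      ∎ }

  lift-inverse : ∀ {P Q} → (∀ x → P ∙ Q ∙ x ≡ x) → ∀ v → lift P (lift Q v) ≡ v
  lift-inverse {P} {Q} inv v = block-ext λ i → trans (block-lift P i (lift Q v))
    (trans (cong (P ∙_) (block-lift Q i v)) (inv (block i v)))

  initialBlocks : Vec F m → Fin (suc n) → Vec F m
  initialBlocks x zero    = x
  initialBlocks x (suc _) = 𝟎

  initial : Vec F m → Vec F (suc n ℕ.* m)
  initial x = fromBlocks (initialBlocks x)

  block-zero-initial : ∀ x → block zero (initial x) ≡ x
  block-zero-initial x = block-fromBlocks (initialBlocks x) zero

  block-suc-initial : ∀ i x → block (suc i) (initial x) ≡ 𝟎
  block-suc-initial i x = block-fromBlocks (initialBlocks x) (suc i)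

  initial-ext : ∀ {v x} → block zero v ≡ x → (∀ i → block (suc i) v ≡ 𝟎) → v ≡ initial x
  initial-ext {v} {x} z s = block-ext λ where
    zero    → trans z (sym (block-zero-initial x))
    (suc i) → trans (s i) (sym (block-suc-initial i x))

  initial-linear : Linear initial
  initial-linear = record
    { +-hom = λ x y → sym (initial-ext
        (trans (+-hom (block-linear zero) _ _) (cong₂ _⊞_ (block-zero-initial x) (block-zero-initial y)))
        (λ i → trans (+-hom (block-linear (suc i)) _ _)
          (trans (cong₂ _⊞_ (block-suc-initial i x) (block-suc-initial i y)) (⊞-identityˡ 𝟎))))
    ; •-hom = λ a x → sym (initial-ext
        (trans (•-hom (block-linear zero) a _) (cong (a •_) (block-zero-initial x)))
        (λ i → trans (•-hom (block-linear (suc i)) a _) (trans (cong (a •_) (block-suc-initial i x)) (•-𝟎 a)))) }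

  initial-injective : ∀ {x y} → initial x ≡ initial y → x ≡ y
  initial-injective {x} {y} eq =
    trans (sym (block-zero-initial x)) (trans (cong (block zero) eq) (block-zero-initial y))

  initial-nonzero : ∀ {x} → x ≢ 𝟎 → initial x ≢ 𝟎
  initial-nonzero x≢𝟎 eq = x≢𝟎 (initial-injective (trans eq (sym (0-hom initial-linear))))

  lift-initial : ∀ P x → lift P (initial x) ≡ initial (P ∙ x)
  lift-initial P x = initial-ext
    (trans (block-lift P zero (initial x)) (cong (P ∙_) (block-zero-initial x)))
    (λ i → trans (block-lift P (suc i) (initial x))
      (trans (cong (P ∙_) (block-suc-initial i x)) (0-hom (∙-linear P))))

  shifted : Fin (suc n) → Vec F (suc n ℕ.* m) → Vec F m
  shifted zero    v = 𝟎
  shifted (suc i) v = block (inject₁ i) v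

  lastBlock : Vec F (suc n ℕ.* m) → Vec F m
  lastBlock = block (fromℕ n)

  IsShift : (Vec F (suc n ℕ.* m) → Vec F (suc n ℕ.* m)) → (Fin (suc n) → F) → Matrix F m → Set
  IsShift T c B = ∀ v i → block i (T v) ≡ shifted i v ⊞ c i • B ∙ lastBlock v

  -- The compatibility of c, B with c′, B′ is asked for at the single vector v. For an arbitrary S
  -- it is at first known only where the last block of v is zero and both sides vanish.
  lift-shift-at : ∀ {T S c c′ B B′} P → IsShift T c B → IsShift S c′ B′ → ∀ v →
    (∀ i → c i • P ∙ B ∙ lastBlock v ≡ c′ i • B′ ∙ P ∙ lastBlock v) →
    lift P (T v) ≡ S (lift P v)
  lift-shift-at {T} {S} {c} {c′} {B} {B′} P shT shS v eq = block-ext λ i → begin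
    block i (lift P (T v))
      ≡⟨ trans (block-lift P i (T v)) (cong (P ∙_) (shT v i)) ⟩
    P ∙ (shifted i v ⊞ c i • B ∙ lastBlock v)
      ≡⟨ trans (+-hom (∙-linear P) (shifted i v) (c i • B ∙ lastBlock v))
           (cong (P ∙ shifted i v ⊞_) (•-hom (∙-linear P) (c i) (B ∙ lastBlock v))) ⟩
    P ∙ shifted i v ⊞ c i • P ∙ B ∙ lastBlock v
      ≡⟨ cong₂ _⊞_ (lift-shifted i)
           (trans (eq i) (cong (λ y → c′ i • B′ ∙ y) (sym (block-lift P (fromℕ n) v)))) ⟩
    shifted i (lift P v) ⊞ c′ i • B′ ∙ lastBlock (lift P v)
      ≡⟨ shS (lift P v) i ⟨
    block i (S (lift P v)) ∎
    where
    lift-shifted : ∀ i → P ∙ shifted i v ≡ shifted i (lift P v)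
    lift-shifted zero    = 0-hom (∙-linear P)
    lift-shifted (suc i) = sym (block-lift P (inject₁ i) v)

  lift-shift : ∀ {T S c B B′} P → IsShift T c B → IsShift S c B′ →
    (∀ x → P ∙ B ∙ x ≡ B′ ∙ P ∙ x) → ∀ v → lift P (T v) ≡ S (lift P v)
  lift-shift {c = c} P shT shS eq v =
    lift-shift-at P shT shS v (λ i → cong (c i •_) (eq (lastBlock v)))

  tsrBlock-last : ∀ (c : Fin (suc n) → F) (B : Matrix F m) i a b →
    tsrBlock c B i (fromℕ n) a b ≡ c i * entry B a b
  tsrBlock-last c B i a b with toℕ (fromℕ n) ℕ.≟ n
  ... | yes _ = refl
  ... | no ≢n = contradiction (Finₚ.toℕ-fromℕ n) ≢n

  inject₁≢n : ∀ (j : Fin n) → toℕ (inject₁ j) ≢ n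
  inject₁≢n j eq = ℕₚ.<⇒≢ (Finₚ.toℕ<n j) (trans (sym (Finₚ.toℕ-inject₁ j)) eq)

  tsrBlock-subdiagonal : ∀ (c : Fin (suc n) → F) (B : Matrix F m) (j : Fin n) a b →
    tsrBlock c B (suc j) (inject₁ j) a b ≡ δ a b
  tsrBlock-subdiagonal c B j a b with toℕ (inject₁ j) ℕ.≟ n
  ... | yes ≡n = contradiction ≡n (inject₁≢n j)
  ... | no _ with toℕ (suc j) ℕ.≟ suc (toℕ (inject₁ j))
  ...   | yes _ = refl
  ...   | no ≢ = contradiction (cong suc (sym (Finₚ.toℕ-inject₁ j))) ≢

  tsrBlock-elsewhere : ∀ (c : Fin (suc n) → F) (B : Matrix F m) i (j : Fin n) a b →
    i ≢ suc j → tsrBlock c B i (inject₁ j) a b ≡ 0#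
  tsrBlock-elsewhere c B i j a b i≢ with toℕ (inject₁ j) ℕ.≟ n
  ... | yes ≡n = contradiction ≡n (inject₁≢n j)
  ... | no _ with toℕ i ℕ.≟ suc (toℕ (inject₁ j))
  ...   | yes eq = contradiction (Finₚ.toℕ-injective (trans eq (cong suc (Finₚ.toℕ-inject₁ j)))) i≢
  ...   | no _ = refl

  tsr-shift : ∀ {T : Matrix F (suc n ℕ.* m)} {c : Fin (suc n) → F} {B} →
    (∀ i j a b → entry T (combine i a) (combine j b) ≡ tsrBlock c B i j a b) →
    IsShift (T ∙_) c B
  tsr-shift {T} {c} {B} tsr v i = lookup-ext λ a → begin
    lookup (block i (T ∙ v)) a
      ≡⟨ trans (lookup-block i (T ∙ v) a) (lookup-∙ T v (combine i a)) ⟩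
    sumF (λ l → entry T (combine i a) l * lookup v l)
      ≡⟨ sum-combine (suc n) {m} (λ l → entry T (combine i a) l * lookup v l) ⟩
    sumF (λ (j : Fin (suc n)) → sumF (λ (b : Fin m) → entry T (combine i a) (combine j b) * lookup v (combine j b)))
      ≡⟨ sum-cong (λ j → sum-cong {m} (λ b →
           cong₂ _*_ (tsr i j a b) (sym (lookup-block j v b)))) ⟩
    sumF (λ j → sumF (λ b → tsrBlock c B i j a b * lookup (block j v) b))
      ≡⟨ sum-last (λ j → sumF (λ b → tsrBlock c B i j a b * lookup (block j v) b)) ⟩
    sumF (λ j → sumF (λ b → tsrBlock c B i (inject₁ j) a b * lookup (block (inject₁ j) v) b)) +
      sumF (λ b → tsrBlock c B i (fromℕ n) a b * lookup (lastBlock v) b)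
      ≡⟨ cong₂ _+_ (shifted-sum i a) (last-sum a) ⟩
    lookup (shifted i v) a + lookup (c i • B ∙ lastBlock v) a
      ≡⟨ lookup-⊞ (shifted i v) (c i • B ∙ lastBlock v) a ⟨
    lookup (shifted i v ⊞ c i • B ∙ lastBlock v) a ∎
    where
    vanishing : ∀ i a j → i ≢ suc j →
      sumF (λ b → tsrBlock c B i (inject₁ j) a b * lookup (block (inject₁ j) v) b) ≡ 0#
    vanishing i a j i≢ = sum-0 λ b →
      trans (cong (_* _) (tsrBlock-elsewhere c B i j a b i≢)) (𝔽ᵣ.zeroˡ _)
    shifted-sum : ∀ i a →
      sumF (λ j → sumF (λ b → tsrBlock c B i (inject₁ j) a b * lookup (block (inject₁ j) v) b))
        ≡ lookup (shifted i v) a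
    shifted-sum zero    a = trans (sum-0 (λ j → vanishing zero a j λ ())) (sym (lookup-𝟎 a))
    shifted-sum (suc i) a = trans
      (sum-single _ i (λ j j≢i → vanishing (suc i) a j (j≢i ∘ sym ∘ Finₚ.suc-injective)))
      (trans (sum-cong (λ b → cong (_* lookup (block (inject₁ i) v) b) (tsrBlock-subdiagonal c B i a b)))
        (sum-δˡ (lookup (block (inject₁ i) v)) a))
    last-sum : ∀ a → sumF (λ b → tsrBlock c B i (fromℕ n) a b * lookup (lastBlock v) b)
      ≡ lookup (c i • B ∙ lastBlock v) a
    last-sum a = begin
      sumF (λ b → tsrBlock c B i (fromℕ n) a b * lookup (lastBlock v) b)
        ≡⟨ sum-cong (λ b → trans (cong (_* lookup (lastBlock v) b) (tsrBlock-last c B i a b)) (𝔽ᵣ.*-assoc _ _ _)) ⟩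
      sumF (λ b → c i * (entry B a b * lookup (lastBlock v) b))
        ≡⟨ sum-* (c i) (λ b → entry B a b * lookup (lastBlock v) b) ⟩
      c i * sumF (λ b → entry B a b * lookup (lastBlock v) b)
        ≡⟨ cong (c i *_) (lookup-∙ B (lastBlock v) a) ⟨
      c i * lookup (B ∙ lastBlock v) a
        ≡⟨ lookup-• (c i) (B ∙ lastBlock v) a ⟨
      lookup (c i • B ∙ lastBlock v) a ∎

  tsrMatrix : (Fin (suc n) → F) → Matrix F m → Matrix F (suc n ℕ.* m)
  tsrMatrix c B = tabulate λ l → tabulate λ l′ →
    let (i , a) = remQuot {suc n} m l ; (j , b) = remQuot {suc n} m l′ in tsrBlock c B i j a b

  entry-tsrMatrix : ∀ c B i j a b →
    entry (tsrMatrix c B) (combine i a) (combine j b) ≡ tsrBlock c B i j a b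
  entry-tsrMatrix c B i j a b = trans (entry-tabulate _ (combine i a) (combine j b))
    (cong₂ (λ (i , a) (j , b) → tsrBlock c B i j a b)
      (Finₚ.remQuot-combine {suc n} {m} i a) (Finₚ.remQuot-combine {suc n} {m} j b))

  -- Block columns before the last contain only an identity block, so basis vectors move from block
  -- to block independently of c and B. A map that commutes with the operators is thereby determined
  -- by its values on the first block.
  shift-unit : ∀ {T : Matrix F (suc n ℕ.* m)} {c : Fin (suc n) → F} {B} →
    (∀ i j a b → entry T (combine i a) (combine j b) ≡ tsrBlock c B i j a b) →
    ∀ (j : Fin n) b → T ∙ unit (combine (inject₁ j) b) ≡ unit (combine (suc j) b)
  shift-unit {T} {c} {B} tsr j b = block-ext λ i → lookup-ext λ a → begin
    lookup (block i (T ∙ unit (combine (inject₁ j) b))) a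
      ≡⟨ trans (lookup-block i (T ∙ unit (combine (inject₁ j) b)) a) (lookup-∙-unit T (combine i a) (combine (inject₁ j) b)) ⟩
    entry T (combine i a) (combine (inject₁ j) b)
      ≡⟨ tsr i (inject₁ j) a b ⟩
    tsrBlock c B i (inject₁ j) a b
      ≡⟨ compare i a ⟩
    δ (combine i a) (combine (suc j) b)
      ≡⟨ trans (lookup-block i (unit (combine (suc j) b)) a) (lookup-unit (combine i a) (combine (suc j) b)) ⟨
    lookup (block i (unit (combine (suc j) b))) a ∎
    where
    compare : ∀ i a → tsrBlock c B i (inject₁ j) a b ≡ δ (combine i a) (combine (suc j) b)
    compare i a with i Fin.≟ suc j
    ... | no i≢ = trans (tsrBlock-elsewhere c B i j a b i≢)
            (sym (δ-≢ (λ e → i≢ (Finₚ.combine-injectiveˡ i a (suc j) b e))))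
    ... | yes refl with a Fin.≟ b
    ...   | yes refl = trans (tsrBlock-subdiagonal c B j a a)
              (trans (δ-refl a) (sym (δ-refl (combine (suc j) a))))
    ...   | no a≢b = trans (tsrBlock-subdiagonal c B j a b)
              (trans (δ-≢ a≢b) (sym (δ-≢ (λ e → a≢b (Finₚ.combine-injectiveʳ (suc j) a (suc j) b e)))))

  unit-initial : ∀ b → unit (combine {suc n} zero b) ≡ initial (unit b)
  unit-initial b = initial-ext
    (lookup-ext λ a → trans (lookup-block zero (unit (combine {suc n} zero b)) a)
      (trans (lookup-unit (combine {suc n} zero a) (combine {suc n} zero b)) (trans (diagonal a) (sym (lookup-unit a b)))))
    (λ i → lookup-ext λ a → trans (lookup-block (suc i) (unit (combine {suc n} zero b)) a)
      (trans (lookup-unit (combine {suc n} (suc i) a) (combine {suc n} zero b))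
        (trans (δ-≢ (λ e → contradiction (Finₚ.combine-injectiveˡ {suc n} (suc i) a zero b e) λ ())) (sym (lookup-𝟎 a)))))
    where
    diagonal : ∀ a → δ (combine {suc n} zero a) (combine {suc n} zero b) ≡ δ a b
    diagonal a with a Fin.≟ b
    ... | yes refl = δ-refl (combine {suc n} zero a)
    ... | no a≢b = δ-≢ (λ e → a≢b (Finₚ.combine-injectiveʳ {suc n} zero a zero b e))

  lastBlock-unit : ∀ (j : Fin n) b → lastBlock (unit (combine (inject₁ j) b)) ≡ 𝟎
  lastBlock-unit j b = lookup-ext λ a → trans (lookup-block (fromℕ n) (unit (combine (inject₁ j) b)) a)
    (trans (lookup-unit (combine (fromℕ n) a) (combine (inject₁ j) b))
      (trans (δ-≢ (λ e → Finₚ.fromℕ≢inject₁ (Finₚ.combine-injectiveˡ (fromℕ n) a (inject₁ j) b e)))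
        (sym (lookup-𝟎 a))))

-- The multiplicative subset of K attached to the first block.

module TSRSystems (𝔽 : FiniteField) (n m : ℕ) (f : FF.Poly 𝔽)
  (monic : Polynomials.Monic 𝔽 (suc n ℕ.* m) f) (irreducible : FF.Irreducible 𝔽 f) where

  open FF 𝔽
  open Polynomials 𝔽
  open LinearAlgebra 𝔽
  open FiniteField 𝔽 using (0#)
  open FiniteVectors 𝔽
  open Blocks 𝔽 n m
  open ≡-Reasoning

  V : Set
  V = Vec F (suc n ℕ.* m)

  -- What T and S share. Of the characteristic polynomial only the annihilation by the common f is
  -- kept, so that the same K acts on V in both ways; `c` and `B` are a chosen factorisation, in
  -- general not determined by the operator.
  record System : Set where
    field
      T            : V → V
      T-linear     : Linear T
      c            : Fin (suc n) → F
      B            : Matrix F m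
      shift        : IsShift T c B
      annihilates  : ∀ v → Action.act T T-linear f v ≡ 𝟎

  -- The exponent q^m - 1, defined without reference to an operator so that it is literally the same
  -- for both systems.
  unitCount : ℕ
  unitCount = length (nonzeroVectors m)

  module At (D : System) {w : Vec F m} (w≢𝟎 : w ≢ 𝟎) where
    open System D
    open Cyclic 𝔽 f monic irreducible T T-linear annihilates public
    module ActB = Action (B ∙_) (∙-linear B)

    ιw≢𝟎 : initial w ≢ 𝟎
    ιw≢𝟎 = initial-nonzero w≢𝟎

    InSpan : Vec F m → Set
    InSpan x = ∃ λ r → ActB.act r w ≡ x

    span-𝟎 : InSpan 𝟎
    span-𝟎 = [] , refl

    span-+ : ∀ {x y} → InSpan x → InSpan y → InSpan (x ⊞ y)
    span-+ (r , eq) (s , eq′) = r +ₚ s , trans (ActB.act-+ r s w) (cong₂ _⊞_ eq eq′)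

    span-• : ∀ a {x} → InSpan x → InSpan (a • x)
    span-• a (r , eq) = scale a r , trans (ActB.act-scale a r w) (cong (a •_) eq)

    span-B : ∀ {x} → InSpan x → InSpan (B ∙ x)
    span-B (r , eq) = 0# ∷ r ,
      trans (cong₂ _⊞_ (0• w) (cong (B ∙_) eq)) (⊞-identityˡ _)

    -- The vectors all of whose blocks lie in F[B]w form a T-stable subspace.
    blocks-span : ∀ p i → InSpan (block i (act p (initial w)))
    blocks-span [] i = subst InSpan (sym (0-hom (block-linear i))) span-𝟎
    blocks-span (a ∷ p) i = subst InSpan
      (sym (trans (+-hom (block-linear i) _ _)
        (cong₂ _⊞_ (•-hom (block-linear i) a _) (shift (act p (initial w)) i))))
      (span-+ (span-• a (initial-blocks i))
        (span-+ (shifted-blocks i) (span-• (c i) (span-B (blocks-span p (fromℕ n))))))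
      where
      initial-blocks : ∀ i → InSpan (block i (initial w))
      initial-blocks zero    = 1ₚ , trans (ActB.act-1 w) (sym (block-zero-initial w))
      initial-blocks (suc i) = subst InSpan (sym (block-suc-initial i w)) span-𝟎
      shifted-blocks : ∀ i → InSpan (shifted i (act p (initial w)))
      shifted-blocks zero    = span-𝟎
      shifted-blocks (suc i) = blocks-span p (inject₁ i)

    abstract
      all-span : ∀ x → InSpan x
      all-span x with cyclic ιw≢𝟎 (initial x)
      ... | p , eq = subst InSpan (trans (cong (block zero) eq) (block-zero-initial x)) (blocks-span p zero)

    InBlock : Poly → Set
    InBlock p = ∃ λ x → x ≢ 𝟎 × act p (initial w) ≡ initial x

    actB-matrix : Poly → Matrix F m
    actB-matrix r = matrixOf (ActB.act r)

    actB-matrix-∙ : ∀ r x → actB-matrix r ∙ x ≡ ActB.act r x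
    actB-matrix-∙ r = matrixOf-∙ (ActB.act-linear r)

    lift-commutes : ∀ r v → lift (actB-matrix r) (T v) ≡ T (lift (actB-matrix r) v)
    lift-commutes r = lift-shift (actB-matrix r) shift shift λ x → begin
      actB-matrix r ∙ B ∙ x  ≡⟨ actB-matrix-∙ r (B ∙ x) ⟩
      ActB.act r (B ∙ x)     ≡⟨ act-intertwine (∙-linear B) (∙-linear B) (∙-linear B) (λ _ → refl) r x ⟨
      B ∙ ActB.act r x       ≡⟨ cong (B ∙_) (actB-matrix-∙ r x) ⟨
      B ∙ actB-matrix r ∙ x  ∎

    act-initial-actB : ∀ p r {x} → act p (initial w) ≡ initial x →
      act p (initial (ActB.act r w)) ≡ initial (actB-matrix r ∙ x)
    act-initial-actB p r {x} eq = begin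
      act p (initial (ActB.act r w))            ≡⟨ cong (λ z → act p (initial z)) (actB-matrix-∙ r w) ⟨
      act p (initial (actB-matrix r ∙ w))       ≡⟨ cong (act p) (lift-initial (actB-matrix r) w) ⟨
      act p (lift (actB-matrix r) (initial w))  ≡⟨ act-intertwine T-linear T-linear (lift-linear (actB-matrix r))
                                                     (lift-commutes r) p (initial w) ⟨
      lift (actB-matrix r) (act p (initial w))  ≡⟨ cong (lift (actB-matrix r)) eq ⟩
      lift (actB-matrix r) (initial x)          ≡⟨ lift-initial (actB-matrix r) x ⟩
      initial (actB-matrix r ∙ x)               ∎

    -- Every y is r(B) w for some r, and I ⊗ r(B) commutes with p and preserves W. So p maps all of
    -- W into W once it maps the single vector w there; closure under products rests on this.
    preserves-initial : ∀ p {x} → act p (initial w) ≡ initial x → ∀ y →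
      ∃ λ z → act p (initial y) ≡ initial z
    preserves-initial p eq y =
      let (r , rw≡y) = all-span y
      in _ , trans (cong (λ y → act p (initial y)) (sym rw≡y)) (act-initial-actB p r eq)

    inBlock-nonzero : ∀ p → InBlock p → act p (initial w) ≢ 𝟎
    inBlock-nonzero p (x , x≢𝟎 , eq) e = initial-nonzero x≢𝟎 (trans (sym eq) e)

    inBlock-* : ∀ p q → InBlock p → InBlock q → InBlock (p *ₚ q)
    inBlock-* p q hp@(x , x≢𝟎 , px) hq@(y , y≢𝟎 , qy) = z , z≢𝟎 , pqz
      where
      z = proj₁ (preserves-initial p px y)
      pqz : act (p *ₚ q) (initial w) ≡ initial z
      pqz = trans (act-* p q (initial w))
        (trans (cong (act p) qy) (proj₂ (preserves-initial p px y)))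
      z≢𝟎 : z ≢ 𝟎
      z≢𝟎 z≡𝟎 = inBlock-nonzero q hq (quotientRing-integral {p = p} {q}
        (trans pqz (trans (cong initial z≡𝟎) (0-hom initial-linear))) (inBlock-nonzero p hp))

    quotientRing-≟ : Decidable (CommutativeRing._≈_ (quotientRing (initial w)))
    quotientRing-≟ p q = act p (initial w) ≟ᵥ act q (initial w)

    quotientRing-nontrivial : Nontrivial (quotientRing (initial w))
    quotientRing-nontrivial e = ιw≢𝟎 (trans (sym (act-1 (initial w))) e)

    quotientRing-noZeroDivisors : NoZeroDivisors (quotientRing (initial w))
    quotientRing-noZeroDivisors p q = quotientRing-integral {p = p} {q}

    open FiniteSubgroup (quotientRing (initial w)) quotientRing-≟ quotientRing-nontrivial quotientRing-noZeroDivisors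
      using (member⇒power≈1; power≈1⇒member)

    abstract
      representative : V → Poly
      representative v = proj₁ (cyclic ιw≢𝟎 v)

      act-representative : ∀ v → act (representative v) (initial w) ≡ v
      act-representative v = proj₂ (cyclic ιw≢𝟎 v)

    units : List Poly
    units = List.map (representative ∘ initial) (nonzeroVectors m)

    representative-inBlock : ∀ {x} → x ≢ 𝟎 → InBlock (representative (initial x))
    representative-inBlock x≢𝟎 = _ , x≢𝟎 , act-representative _

    inBlock⇒unit : ∀ {p} → InBlock p → Any (λ q → act p (initial w) ≡ act q (initial w)) units
    inBlock⇒unit (x , x≢𝟎 , eq) = Anyₚ.map⁺ (Any.map
      (λ { refl → trans eq (sym (act-representative (initial x))) }) (nonzero-∈ x≢𝟎))

    unit⇒inBlock : ∀ {p} → Any (λ q → act p (initial w) ≡ act q (initial w)) units → InBlock p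
    unit⇒inBlock p∈ with find (Anyₚ.map⁻ p∈)
    ... | x , x∈ , eq = x , ∈-nonzero x∈ , trans eq (act-representative (initial x))

    units-inBlock : ∀ {P : Poly → Set} → (∀ p → InBlock p → P p) → All P units
    units-inBlock h = Allₚ.map⁺ (All.tabulate (λ x∈ → h _ (representative-inBlock (∈-nonzero x∈))))

    units-distinct : AllPairs (λ p q → ¬ act p (initial w) ≡ act q (initial w)) units
    units-distinct = AllPairsₚ.map⁺ (AllPairs.map
      (λ {x} {y} x≢y e → x≢y (initial-injective
        (trans (sym (act-representative (initial x))) (trans e (act-representative (initial y))))))
      (nonzeroVectors-unique m))

    units-closed : ∀ p → InBlock p →
      All (λ q → Any (λ r → act (p *ₚ q) (initial w) ≡ act r (initial w)) units) units
    units-closed p hp = units-inBlock λ q hq → inBlock⇒unit {p *ₚ q} (inBlock-* p q hp hq)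

    length-units : length units ≡ unitCount
    length-units = Listₚ.length-map _ (nonzeroVectors m)

    powerₚ : Poly → ℕ → Poly
    powerₚ = power _*ₚ_ 1ₚ

    -- The power condition depends only on f, by annihilator-multiple.
    inBlock⇒power≡1 : ∀ p → InBlock p →
      act (powerₚ p unitCount) (initial w) ≡ act 1ₚ (initial w)
    inBlock⇒power≡1 p hp = subst (λ k → act (powerₚ p k) (initial w) ≡ act 1ₚ (initial w)) length-units
      (member⇒power≈1 units units-distinct (units-inBlock inBlock-nonzero) {p}
        (inBlock-nonzero p hp) (units-closed p hp))

    power≡1⇒inBlock : ∀ p → act (powerₚ p unitCount) (initial w) ≡ act 1ₚ (initial w) → InBlock p
    power≡1⇒inBlock p e = unit⇒inBlock {p} (power≈1⇒member units units-distinct (units-inBlock inBlock-nonzero)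
      (inBlock⇒unit {1ₚ} (w , w≢𝟎 , act-1 (initial w)))
      (units-inBlock units-closed) {p}
      (subst (λ k → act (powerₚ p k) (initial w) ≡ act 1ₚ (initial w)) (sym length-units) e))

  -- The F[X]-isomorphism from (V, T) to (V, S) with w ↦ u.

  module Transport (D E : System) {w u : Vec F m} (w≢𝟎 : w ≢ 𝟎) (u≢𝟎 : u ≢ 𝟎) where
    open System D
    open System E using () renaming (T to S; T-linear to S-linear; annihilates to S-annihilates)
    module D = At D w≢𝟎
    module E = At E u≢𝟎

    transfer-multiple : ∀ p q s → (p +ₚ (-ₚ q)) ≋ (f *ₚ s) → E.act p (initial u) ≡ E.act q (initial u)
    transfer-multiple p q s p-q≋fs = begin
      E.act p (initial u)                 ≡⟨ E.act-cong {p} {(f *ₚ s) +ₚ q} p≋fs+q (initial u) ⟩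
      E.act ((f *ₚ s) +ₚ q) (initial u)   ≡⟨ E.act-+ (f *ₚ s) q (initial u) ⟩
      E.act (f *ₚ s) (initial u) ⊞ E.act q (initial u)
        ≡⟨ cong (_⊞ E.act q (initial u)) (E.act-multiple {f *ₚ s} {s} ≋-refl (initial u)) ⟩
      𝟎 ⊞ E.act q (initial u)             ≡⟨ ⊞-identityˡ (E.act q (initial u)) ⟩
      E.act q (initial u)                 ∎
      where
      module Pₛ = IntegerSolver polyRing
      p≋fs+q : p ≋ ((f *ₚ s) +ₚ q)
      p≋fs+q = ≋-trans
        (Pₛ.solve 2 (λ p q → p Pₛ.:= (p Pₛ.:- q) Pₛ.:+ q) ≋-refl p q)
        (+ₚ-cong {q = q} p-q≋fs ≋-refl)

    -- Agreement on w means that f divides p - q, a statement in which neither operator occurs. It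
    -- makes φ independent of the representative and carries the power condition across.
    transfer : ∀ p q → D.act p (initial w) ≡ D.act q (initial w) →
      E.act p (initial u) ≡ E.act q (initial u)
    transfer p q eq =
      let (s , p-q≋fs) = D.annihilator-multiple (p +ₚ (-ₚ q)) D.ιw≢𝟎 (D.act-sub p q (initial w) eq)
      in transfer-multiple p q s p-q≋fs

    φ : V → V
    φ v = E.act (D.representative v) (initial u)

    φ-act : ∀ p {v} → D.act p (initial w) ≡ v → φ v ≡ E.act p (initial u)
    φ-act p {v} eq = transfer (D.representative v) p (trans (D.act-representative v) (sym eq))

    φ-linear : Linear φ
    φ-linear = record
      { +-hom = λ v v′ →
          let p = D.representative v ; q = D.representative v′ in trans
          (φ-act (p +ₚ q) (trans (D.act-+ p q (initial w))
            (cong₂ _⊞_ (D.act-representative v) (D.act-representative v′))))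
          (E.act-+ p q (initial u))
      ; •-hom = λ a v →
          let p = D.representative v in trans
          (φ-act (scale a p) (trans (D.act-scale a p (initial w)) (cong (a •_) (D.act-representative v))))
          (E.act-scale a p (initial u)) }

    φ-intertwines : ∀ v → φ (T v) ≡ S (φ v)
    φ-intertwines v = trans
      (φ-act (0# ∷ D.representative v)
        (trans (cong₂ _⊞_ (0• (initial w)) (cong T (D.act-representative v))) (⊞-identityˡ (T v))))
      (trans (cong (_⊞ S (φ v)) (0• (initial u))) (⊞-identityˡ (S (φ v))))

    -- The crossing from T to S: an element p with p w in W satisfies the power equation, which
    -- transfers, and for S the same equation forces p u into W.
    φ-initial-nonzero : ∀ {x} → x ≢ 𝟎 → E.InBlock (D.representative (initial x))
    φ-initial-nonzero {x} x≢𝟎 = E.power≡1⇒inBlock p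
      (transfer (D.powerₚ p unitCount) 1ₚ (D.inBlock⇒power≡1 p (D.representative-inBlock x≢𝟎)))
      where p = D.representative (initial x)

    φ-initial-image : ∀ x → ∃ λ y → φ (initial x) ≡ initial y
    φ-initial-image x = helper (x ≟ᵥ 𝟎)
      where
      helper : Dec (x ≡ 𝟎) → ∃ λ y → φ (initial x) ≡ initial y
      helper (yes x≡𝟎) = 𝟎 , (begin
        φ (initial x)  ≡⟨ cong (φ ∘ initial) x≡𝟎 ⟩
        φ (initial 𝟎)  ≡⟨ cong φ (0-hom initial-linear) ⟩
        φ 𝟎            ≡⟨ 0-hom φ-linear ⟩
        𝟎              ≡⟨ 0-hom initial-linear ⟨
        initial 𝟎      ∎)
      helper (no x≢𝟎) = let (y , _ , eq) = φ-initial-nonzero x≢𝟎 in y , eq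

    P : Matrix F m
    P = matrixOf (block zero ∘ φ ∘ initial)

    φ-initial : ∀ x → φ (initial x) ≡ initial (P ∙ x)
    φ-initial x = let (y , eq) = φ-initial-image x in trans eq (cong initial (begin
      y                             ≡⟨ block-zero-initial y ⟨
      block zero (initial y)        ≡⟨ cong (block zero) eq ⟨
      block zero (φ (initial x))    ≡⟨ matrixOf-∙ (Linear-∘ (block-linear zero) (Linear-∘ φ-linear initial-linear)) x ⟨
      P ∙ x                         ∎))

    P-w : P ∙ w ≡ u
    P-w = initial-injective (begin
      initial (P ∙ w)           ≡⟨ φ-initial w ⟨
      φ (initial w)             ≡⟨ φ-act 1ₚ (D.act-1 (initial w)) ⟩
      E.act 1ₚ (initial u)      ≡⟨ E.act-1 (initial u) ⟩
      initial u                 ∎)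

  module Inverse (D E : System) {w u : Vec F m} (w≢𝟎 : w ≢ 𝟎) (u≢𝟎 : u ≢ 𝟎) where
    module To   = Transport D E w≢𝟎 u≢𝟎
    module From = Transport E D u≢𝟎 w≢𝟎

    From∘To : ∀ x → From.P ∙ To.P ∙ x ≡ x
    From∘To x = initial-injective (begin
      initial (From.P ∙ To.P ∙ x)      ≡⟨ From.φ-initial (To.P ∙ x) ⟨
      From.φ (initial (To.P ∙ x))      ≡⟨ cong From.φ (To.φ-initial x) ⟨
      From.φ (To.φ (initial x))        ≡⟨ From.φ-act (To.D.representative (initial x)) refl ⟩
      To.D.act (To.D.representative (initial x)) (initial w) ≡⟨ To.D.act-representative (initial x) ⟩
      initial x                        ∎)

-- Counting the pairs (S, u) by GL_m.

module Counting (𝔽 : FiniteField) (n m : ℕ) {w : Vec (FF.F 𝔽) m} (w≢𝟎 : w ≢ LinearAlgebra.𝟎 𝔽)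
  (T : Matrix (FF.F 𝔽) (suc n ℕ.* m)) (T-tsri : FF.IsTSRI 𝔽 m (suc n) T) where

  open FF 𝔽
  open Polynomials 𝔽
  open LinearAlgebra 𝔽
  open FiniteField 𝔽 using (size)
  open FiniteVectors 𝔽
  open CayleyHamilton 𝔽
  open Blocks 𝔽 n m
  open ≡-Reasoning

  f : Poly
  f = charPoly T

  open TSRSystems 𝔽 n m f (charPoly-monic T) (proj₂ T-tsri)

  SameCharPoly : Matrix F (suc n ℕ.* m) → Set
  SameCharPoly S = IsTSR m (suc n) S × charPoly S ≈ₚ f

  system : ∀ {S} → SameCharPoly S → System
  system {S} ((c , B , tsr) , same) = record
    { T = S ∙_ ; T-linear = ∙-linear S ; c = c ; B = B ; shift = tsr-shift {S} {c} {B} tsr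
    ; annihilates = λ v → trans
        (Action.act-cong (S ∙_) (∙-linear S) {f} {charPoly S} (ext (sym ∘ same)) v) (cayley-hamilton S v) }

  T-same : SameCharPoly T
  T-same = proj₁ T-tsri , λ _ → refl

  -- The graph of the bijection, with S given by the intertwining equation instead of a formula for
  -- the conjugate. As a relation it serves both inequalities of the count, each needing existence
  -- of a partner and uniqueness in one direction.
  Transforms : Matrix F m → Matrix F (suc n ℕ.* m) × Vec F m → Set
  Transforms P (S , u) = IsGL P × (∀ v → lift P (T ∙ v) ≡ S ∙ lift P v) × P ∙ w ≡ u

  isGL-∙ : ∀ {P Q : Matrix F m} → (∀ x → P ∙ Q ∙ x ≡ x) → P · Q ≡ idMat
  isGL-∙ {P} {Q} inv = ∙-injective λ x → trans (·-∙ P Q x) (trans (inv x) (sym (idMat-∙ x)))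

  ∙-inverse : ∀ {P Q : Matrix F m} → P · Q ≡ idMat → ∀ x → P ∙ Q ∙ x ≡ x
  ∙-inverse {P} {Q} eq x = trans (sym (·-∙ P Q x)) (trans (cong (_∙ x) eq) (idMat-∙ x))

  transforms-to : ∀ {P} → IsGL P → ∃ λ S → SameCharPoly S × Transforms P (S , P ∙ w)
  transforms-to {P} gl@(Q , PQ , QP) = S ,
    ((c , B′ , entry-tsrMatrix c B′) , at S≋f) , gl , intertwines , refl
    where
    open System (system {T} T-same) using (c; B; shift)
    -- Conjugation by I ⊗ P leaves the identity blocks and c as they are and turns B into P B P⁻¹.
    B′ = (P · B) · Q
    S = tsrMatrix c B′
    module AT = Action (T ∙_) (∙-linear T)
    module AS = Action (S ∙_) (∙-linear S)
    intertwines : ∀ v → lift P (T ∙ v) ≡ S ∙ lift P v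
    intertwines = lift-shift P shift (tsr-shift {S} {c} {B′} (entry-tsrMatrix c B′)) λ x → sym (begin
      ((P · B) · Q) ∙ P ∙ x   ≡⟨ ·-∙ (P · B) Q (P ∙ x) ⟩
      (P · B) ∙ Q ∙ P ∙ x     ≡⟨ cong ((P · B) ∙_) (∙-inverse QP x) ⟩
      (P · B) ∙ x             ≡⟨ ·-∙ P B x ⟩
      P ∙ B ∙ x               ∎)
    f-annihilates : ∀ v → AS.act f v ≡ 𝟎
    f-annihilates v = begin
      AS.act f v                     ≡⟨ cong (AS.act f) (lift-inverse {P} {Q} (∙-inverse PQ) v) ⟨
      AS.act f (lift P (lift Q v))   ≡⟨ act-intertwine (∙-linear T) (∙-linear S) (lift-linear P) intertwines f (lift Q v) ⟨
      lift P (AT.act f (lift Q v))   ≡⟨ cong (lift P) (cayley-hamilton T (lift Q v)) ⟩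
      lift P 𝟎                       ≡⟨ 0-hom (lift-linear P) ⟩
      𝟎                              ∎
    S≋f : charPoly S ≋ f
    S≋f = Cyclic.annihilator-unique 𝔽 f (charPoly-monic T) (proj₂ T-tsri) (S ∙_) (∙-linear S) f-annihilates
      (initial-nonzero w≢𝟎) (charPoly-monic S) (cayley-hamilton S (initial w))

  -- I ⊗ P and I ⊗ P′ are F[X]-linear maps into the same module that agree on the generator w.
  transforms-unique : ∀ {P P′ Su} → Transforms P Su → Transforms P′ Su → P ≡ P′
  transforms-unique {P} {P′} {S , u} (_ , eq , Pw) (_ , eq′ , P′w) =
    ∙-injective λ x → initial-injective (trans (sym (lift-initial P x))
      (trans (agree (initial x)) (lift-initial P′ x)))
    where
    module D = At (system {T} T-same) w≢𝟎
    module AS = Action (S ∙_) (∙-linear S)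
    P-initial≡P′-initial : lift P (initial w) ≡ lift P′ (initial w)
    P-initial≡P′-initial = begin
      lift P (initial w)   ≡⟨ lift-initial P w ⟩
      initial (P ∙ w)      ≡⟨ cong initial (trans Pw (sym P′w)) ⟩
      initial (P′ ∙ w)     ≡⟨ lift-initial P′ w ⟨
      lift P′ (initial w)  ∎
    agree-act : ∀ p → lift P (D.act p (initial w)) ≡ lift P′ (D.act p (initial w))
    agree-act p = begin
      lift P (D.act p (initial w))       ≡⟨ act-intertwine (∙-linear T) (∙-linear S) (lift-linear P) eq p (initial w) ⟩
      AS.act p (lift P (initial w))      ≡⟨ cong (AS.act p) P-initial≡P′-initial ⟩
      AS.act p (lift P′ (initial w))     ≡⟨ act-intertwine (∙-linear T) (∙-linear S) (lift-linear P′) eq′ p (initial w) ⟨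
      lift P′ (D.act p (initial w))      ∎
    agree : ∀ v → lift P v ≡ lift P′ v
    agree v = let (p , pw≡v) = D.cyclic D.ιw≢𝟎 v in
      subst (λ v → lift P v ≡ lift P′ v) pw≡v (agree-act p)

  -- Since I ⊗ P is onto, the intertwining equation fixes S on all of V.
  transforms-functional : ∀ {P Su Su′} → Transforms P Su → Transforms P Su′ → Su ≡ Su′
  transforms-functional {P} {S , u} {S′ , u′} ((Q , PQ , _) , eq , Pw) (_ , eq′ , Pw′) =
    cong₂ _,_ (∙-injective λ v → begin
      S ∙ v                    ≡⟨ cong (S ∙_) (PQv v) ⟨
      S ∙ lift P (lift Q v)    ≡⟨ eq (lift Q v) ⟨
      lift P (T ∙ lift Q v)    ≡⟨ eq′ (lift Q v) ⟩
      S′ ∙ lift P (lift Q v)   ≡⟨ cong (S′ ∙_) (PQv v) ⟩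
      S′ ∙ v                   ∎)
    (trans (sym Pw) Pw′)
    where
    PQv = lift-inverse {P} {Q} (∙-inverse PQ)

  transforms-from : ∀ {S u} → SameCharPoly S → u ≢ 𝟎 → ∃ λ P → Transforms P (S , u)
  transforms-from {S} {u} same u≢𝟎 = To.P ,
    -- Exchanging the two systems, and w with u, turns `From∘To` into the other one-sided inverse.
    (From.P , isGL-∙ {To.P} {From.P} (Inverse.From∘To E D u≢𝟎 w≢𝟎) , isGL-∙ {From.P} {To.P} From∘To) ,
    intertwines , To.P-w
    where
    D = system {T} T-same
    E = system {S} same
    open Inverse D E w≢𝟎 u≢𝟎
    tsrT = proj₂ (proj₂ (proj₁ T-same))
    tsrS = proj₂ (proj₂ (proj₁ same))
    -- On the first block φ is P by the choice of P. The step from block j to the next uses that φ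
    -- commutes with the operators everywhere, while I ⊗ P does so for now only at basis vectors
    -- outside the last block, where c and B contribute nothing.
    φ-unit : ∀ j b → To.φ (unit (combine {suc n} j b)) ≡ lift To.P (unit (combine j b))
    φ-unit j b = <-weakInduction (λ j → To.φ (unit (combine {suc n} j b)) ≡ lift To.P (unit (combine j b)))
      (begin
        To.φ (unit (combine {suc n} zero b))       ≡⟨ cong To.φ (unit-initial b) ⟩
        To.φ (initial (unit b))                    ≡⟨ To.φ-initial (unit b) ⟩
        initial (To.P ∙ unit b)                    ≡⟨ lift-initial To.P (unit b) ⟨
        lift To.P (initial (unit b))               ≡⟨ cong (lift To.P) (unit-initial b) ⟨
        lift To.P (unit (combine {suc n} zero b))  ∎)
      (λ j eq → begin
        To.φ (unit (combine {suc n} (suc j) b))             ≡⟨ cong To.φ (shift-unit {T} tsrT j b) ⟨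
        To.φ (T ∙ unit (combine (inject₁ j) b))             ≡⟨ To.φ-intertwines _ ⟩
        S ∙ To.φ (unit (combine (inject₁ j) b))             ≡⟨ cong (S ∙_) eq ⟩
        S ∙ lift To.P (unit (combine (inject₁ j) b))
          ≡⟨ lift-shift-at To.P (System.shift D) (System.shift E) (unit (combine (inject₁ j) b)) (λ i →
               trans (vanish (System.c D i) To.P (System.B D) j) (sym (vanish (System.c E i) (System.B E) To.P j))) ⟨
        lift To.P (T ∙ unit (combine (inject₁ j) b))        ≡⟨ cong (lift To.P) (shift-unit {T} tsrT j b) ⟩
        lift To.P (unit (combine {suc n} (suc j) b))        ∎)
      j
      where
      vanish : ∀ a (M N : Matrix F m) j → a • M ∙ N ∙ lastBlock (unit (combine (inject₁ j) b)) ≡ 𝟎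
      vanish a M N j = begin
        a • M ∙ N ∙ lastBlock (unit (combine (inject₁ j) b))  ≡⟨ cong (λ x → a • M ∙ N ∙ x) (lastBlock-unit j b) ⟩
        a • M ∙ N ∙ 𝟎   ≡⟨ cong (λ x → a • M ∙ x) (0-hom (∙-linear N)) ⟩
        a • M ∙ 𝟎       ≡⟨ cong (a •_) (0-hom (∙-linear M)) ⟩
        a • 𝟎           ≡⟨ •-𝟎 a ⟩
        𝟎               ∎
    φ-lift : ∀ v → To.φ v ≡ lift To.P v
    φ-lift = linear-ext To.φ-linear (lift-linear To.P) λ l →
      let (j , b , eq) = Finₚ.combine-surjective {suc n} {m} l
      in subst (λ l → To.φ (unit l) ≡ lift To.P (unit l)) eq (φ-unit j b)
    intertwines : ∀ v → lift To.P (T ∙ v) ≡ S ∙ lift To.P v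
    intertwines v = trans (sym (φ-lift (T ∙ v))) (trans (To.φ-intertwines v) (cong (S ∙_) (φ-lift v)))

  count : ∀ {N G} → HasCard SameCharPoly N → HasCard (IsGL {m}) G →
    N ℕ.* (size ^ m ∸ 1) ≡ G
  count {N} {G} (Ss , Ss-unique , Ss⇔ , Ss-length) (Ps , Ps-unique , Ps⇔ , Ps-length) = begin
    N ℕ.* (size ^ m ∸ 1)                   ≡⟨ cong₂ ℕ._*_ Ss-length (length-nonzeroVectors m) ⟨
    length Ss ℕ.* length (nonzeroVectors m) ≡⟨ length-cartesianProductWith _,_ Ss (nonzeroVectors m) ⟨
    length pairs                           ≡⟨ ℕₚ.≤-antisym pairs≤Ps Ps≤pairs ⟩
    length Ps                              ≡⟨ Ps-length ⟩
    G                                      ∎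
    where
    pairs = List.cartesianProduct Ss (nonzeroVectors m)
    pairs≤Ps : length pairs ≤ length Ps
    pairs≤Ps = length-≤-by-relation (λ Su P → Transforms P Su)
      (Uniqueₚ.cartesianProduct⁺ Ss-unique (nonzeroVectors-unique m))
      (λ {(S , u)} Su∈ →
        let (S∈ , u∈) = ∈-cartesianProduct⁻ Ss (nonzeroVectors m) Su∈
            (P , t) = transforms-from (Equivalence.to (Ss⇔ S) S∈) (∈-nonzero u∈)
        in P , Equivalence.from (Ps⇔ P) (proj₁ t) , t)
      transforms-functional
    Ps≤pairs : length Ps ≤ length pairs
    Ps≤pairs = length-≤-by-relation Transforms Ps-unique
      (λ {P} P∈ →
        let gl = Equivalence.to (Ps⇔ P) P∈
            (S , same , t) = transforms-to gl
        in (S , P ∙ w)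
           , ∈-cartesianProduct⁺ (Equivalence.from (Ss⇔ S) same) (nonzero-∈ (image-nonzero gl))
           , t)
      transforms-unique
      where
      image-nonzero : ∀ {P} → IsGL P → P ∙ w ≢ 𝟎
      image-nonzero {P} (Q , _ , QP) e = w≢𝟎 (begin
        w          ≡⟨ ∙-inverse QP w ⟨
        Q ∙ P ∙ w  ≡⟨ cong (Q ∙_) e ⟩
        Q ∙ 𝟎      ≡⟨ 0-hom (∙-linear Q) ⟩
        𝟎          ∎)

unit-nonzero : (𝔽 : FiniteField) → ∀ {k} (i : Fin k) → LinearAlgebra.unit 𝔽 i ≢ LinearAlgebra.𝟎 𝔽
unit-nonzero 𝔽 i eq = FiniteField.0≢1 𝔽 (trans (sym (lookup-𝟎 i))
  (trans (cong (λ v → lookup v i) (sym eq)) (trans (lookup-unit i i) (δ-refl i))))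
  where open LinearAlgebra 𝔽

open import Data.Nat using (_*_)

theorem3p6 : (𝔽 : FiniteField) → IsPrimePower (FiniteField.size 𝔽) →
    (m n : ℕ) → 1 ≤ m → 1 ≤ n → 1 < m ⊔ n →
    let open FF 𝔽 in
    (T : Matrix F (n * m)) → IsTSRI m n T →
    (N G : ℕ) →
    HasCard (λ (S : Matrix F (n * m)) → IsTSR m n S × charPoly S ≈ₚ charPoly T) N →
    HasCard (λ (M : Matrix F m) → IsGL M) G →
    N * (FiniteField.size 𝔽 ^ m ∸ 1) ≡ G
-- The fixed nonzero vector w is the first unit vector of F^m, which exists because m is positive.
theorem3p6 𝔽 _ (suc m) (suc n) _ _ _ T T-tsri N G =
  Counting.count 𝔽 n (suc m) (unit-nonzero 𝔽 zero) T T-tsri
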